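{- Let $k$ be a positive integer and let $w,w'\in[\overline k]^{*}$ be words. Then $w\equiv_C w'$ if and only if $P_C(w)=P_C(w')$.
   Context: Alphabet and tableaux. $[\overline{k}]=\{1,\overline1,\dots,k,\overline k\}$ with the total order $1<\overline1<2<\overline2<\cdots<k<\overline k$; $[\overline k]^{*}$ is the set of all finite words (including the empty word) in $[\overline k]$. Partitions are identified with Young diagrams in English notation. A King tableau of shape $\lambda$ is a filling of the Young diagram $\lambda$ by elements of $[\overline k]$ such that entries weakly increase along rows, strictly increase down columns, and all entries in row $i$ are $\ge i$ (for the order $1<\overline1<2<\overline2<\cdots<k<\overline k$) for every $i$. $\mathrm{KT}_k(\lambda)$ is the set of these and $\mathrm{KT}_k=\bigcup_\lambda \mathrm{KT}_k(\lambda)$ (the empty tableau is included). Berele insertion $T\leftarrow_C x$ ($T\in\mathrm{KT}_k$, $x\in[\overline k]$). Start as in Schensted row insertion: insert $x$ into row 1; inserting a letter $a$ into a row replaces (bumps) the leftmost entry that is strictly larger than $a$, and the bumped entry is then inserted into the next row; if no entry of the row is larger than $a$, then $a$ is put at the end of the row and the procedure stops. Exception: if at some moment the letter $i$ is to be inserted into row $i$ and row $i$ contains at least one $\overline i$, then instead: replace the first $\overline i$ of row $i$ by $i$, replace the first $i$ of row $i$ by an empty box, and play jeu de taquin with this empty box: repeatedly, if the empty box has a box with entry $b$ below it and/or a box with entry $r$ to its right, slide $b$ up when only $b$ exists or when both exist and $b\le r$, and slide $r$ left when only $r$ exists or when both exist and $b>r$; once the empty box is at a corner of the shape, delete it and stop.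 The result is again a King tableau. For a word $w=w_1\cdots w_n$, $P_C(w)=(\cdots((\emptyset\leftarrow_C w_1)\leftarrow_C w_2)\cdots)\leftarrow_C w_n$. Knuth equivalences. $\equiv_A$ is the equivalence relation on $[\overline k]^{*}$ generated by the following replacements of three adjacent letters in a word: $yxz\leftrightarrow yzx$ for $x<y\le z$, and $xzy\leftrightarrow zxy$ for $x\le y<z$. A column word is a word $c=c_n\cdots c_1$ in $[\overline k]$ with $c_{i+1}>c_i$ for all $i$ (the empty word is allowed). For column words, $c\sim c'$ means $P_C(c)=P_C(c')$. Write $w\equiv_5 w'$ if there exist a word $v$ and column words $c,c'$ with $w\equiv_A cv$, $w'\equiv_A c'v$ and $c\sim c'$. Type C Knuth equivalence $\equiv_C$: $w\equiv_C w'$ if there is a finite sequence of words $w=w_0,w_1,\dots,w_n=w'$ such that each $w_{j+1}$ is obtained from $w_j$ by one of the three-letter replacements $yxz\leftrightarrow yzx$ (for $x<y\le z$) and $xzy\leftrightarrow zxy$ (for $x\le y<z$) or satisfies $w_j\equiv_5 w_{j+1}$. -}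

module Defs where

open import Data.Fin using (Fin; toℕ)
import Data.Fin.Properties as Fin
open import Data.List using (List; []; _∷_; _++_; _∷ʳ_; foldl; length; break; splitAt)
open import Data.List.Relation.Unary.Linked using (Linked)
open import Data.Maybe using (Maybe; just; nothing)
open import Data.Nat using (ℕ; suc; _+_; _*_)
import Data.Nat as ℕ
import Data.Nat.Properties as ℕ
open import Data.Product using (_×_; _,_; ∃-syntax)
open import Relation.Binary.Core using (Rel)
open import Relation.Binary.Construct.Closure.Equivalence using (EqClosure)
open import Relation.Binary.Construct.Closure.ReflexiveTransitive using (Star)
open import Relation.Binary.Construct.Closure.Symmetric using (SymClosure)
open import Relation.Binary.Construct.Union using (_∪_)
open import Relation.Binary.Definitions using (Decidable; DecidableEquality)
open import Relation.Binary.PropositionalEquality using (_≡_; refl; cong)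
open import Relation.Nullary using (yes; no)
open import Relation.Nullary.Decidable using (map′)
open import Level using (0ℓ)

-- The letters 1 , 1̄ , … , k , k̄.  Indices are 0-based: `plain i` is the
-- letter i+1 and `bar i` is its barred version.
data Letter (k : ℕ) : Set where
  plain bar : Fin k → Letter k

-- Position of a letter in 1 < 1̄ < 2 < 2̄ < ⋯ < k < k̄, counted from 0.
rank : ∀ {k} → Letter k → ℕ
rank (plain i) = 2 * toℕ i
rank (bar i)   = 2 * toℕ i + 1

infix 4 _<_ _≤_ _<?_ _≟_

_<_ _≤_ : ∀ {k} → Rel (Letter k) 0ℓ
x < y = rank x ℕ.< rank y
x ≤ y = rank x ℕ.≤ rank y

_<?_ : ∀ {k} → Decidable (_<_ {k})
x <? y = rank x ℕ.<? rank y

_≟_ : ∀ {k} → DecidableEquality (Letter k)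
plain i ≟ plain j = map′ (cong plain) (λ { refl → refl }) (i Fin.≟ j)
plain i ≟ bar j   = no λ ()
bar i   ≟ plain j = no λ ()
bar i   ≟ bar j   = map′ (cong bar) (λ { refl → refl }) (i Fin.≟ j)

Word : ℕ → Set
Word k = List (Letter k)

Row : ℕ → Set
Row k = List (Letter k)

-- Fillings, as the list of their rows from top to bottom, each row read from
-- left to right.  The operations below are defined on all such lists; on King
-- tableaux (written without empty rows) they are the usual ones.
Tableau : ℕ → Set
Tableau k = List (Row k)

-- A row that has lost its only box disappears, so that each tableau has a
-- unique representation.
prepend : ∀ {k} → Row k → Tableau k → Tableau k
prepend []      t = t
prepend (x ∷ r) t = (x ∷ r) ∷ t

-- Jeu de taquin, for as long as the empty box stays in one row.  In
-- `slideRow l r d` the row is l , □ , r with the empty box □ in column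
-- `length l` (from 0), and d is the row below it.
-- `stop row`: the box has become a corner and is deleted, leaving `row`.
-- `down row l′ r′`: the box has moved down, completing this row to `row` and
-- turning the row below into l′ , □ , r′.
data RowSlide (k : ℕ) : Set where
  stop : Row k → RowSlide k
  down : Row k → Row k → Row k → RowSlide k

slideRow : ∀ {k} → Row k → Row k → Row k → RowSlide k
slideRow l []      d with splitAt (length l) d
... | _  , []     = stop l
... | l′ , b ∷ r′ = down (l ∷ʳ b) l′ r′
slideRow l (x ∷ r) d with splitAt (length l) d
... | _  , []     = slideRow (l ∷ʳ x) r d
... | l′ , b ∷ r′ with x <? b
...   | yes _ = slideRow (l ∷ʳ x) r d
...   | no  _ = down (l ++ b ∷ x ∷ r) l′ r′

-- In `slide l r t` the current row is l , □ , r and t lists the rows below it.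
-- Without a row below, the box slides to the right end of its row.
slide : ∀ {k} → Row k → Row k → Tableau k → Tableau k
slide l r []      = prepend (l ++ r) []
slide l r (d ∷ t) with slideRow l r d
... | stop row       = prepend row (d ∷ t)
... | down row l′ r′ = row ∷ slide l′ r′ t

-- If the letter i is to be inserted into row i and that row contains ī, the
-- result is the pair of parts of the row to the left and to the right of the
-- empty box created by replacing the first ī by i and then the first i by an
-- empty box; otherwise it is `nothing`.
cancel : ∀ {k} → ℕ → Letter k → Row k → Maybe (Row k × Row k)
cancel n (bar i)   row = nothing
cancel n (plain i) row with toℕ i ℕ.≟ n | break (_≟ bar i) row
... | no  _ | _         = nothing
... | yes _ | _ , []    = nothing
... | yes _ | l , _ ∷ r with break (_≟ plain i) (l ++ plain i ∷ r)
...   | _  , []     = nothing  -- impossible: plain i occurs in the row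
...   | l′ , _ ∷ r′ = just (l′ , r′)

-- `insertFrom n x t` inserts x into the first row of t, which is row n
-- (counted from 0) of the whole tableau.
insertFrom : ∀ {k} → ℕ → Letter k → Tableau k → Tableau k
insertFrom n x []        = (x ∷ []) ∷ []
insertFrom n x (row ∷ t) with cancel n x row
... | just (l , r) = slide l r t
... | nothing with break (x <?_) row
...   | l , []    = (l ∷ʳ x) ∷ t
...   | l , y ∷ r = (l ++ x ∷ r) ∷ insertFrom (suc n) y t

infixl 5 _←C_

_←C_ : ∀ {k} → Tableau k → Letter k → Tableau k
t ←C x = insertFrom 0 x t

P-C : ∀ {k} → Word k → Tableau k
P-C = foldl _←C_ []

data KnuthMove {k : ℕ} : Rel (Word k) 0ℓ where
  yxz→yzx : ∀ u v {x y z} → x < y → y ≤ z →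
            KnuthMove (u ++ y ∷ x ∷ z ∷ v) (u ++ y ∷ z ∷ x ∷ v)
  xzy→zxy : ∀ u v {x y z} → x ≤ y → y < z →
            KnuthMove (u ++ x ∷ z ∷ y ∷ v) (u ++ z ∷ x ∷ y ∷ v)

infix 4 _≡A_ _∼_ _≡5_ _≡C_

_≡A_ : ∀ {k} → Rel (Word k) 0ℓ
_≡A_ = EqClosure KnuthMove

-- Strictly decreasing when read from left to right.
ColumnWord : ∀ {k} → Word k → Set
ColumnWord = Linked (λ x y → y < x)

_∼_ : ∀ {k} → Rel (Word k) 0ℓ
c ∼ c′ = P-C c ≡ P-C c′

_≡5_ : ∀ {k} → Rel (Word k) 0ℓ
w ≡5 w′ = ∃[ v ] ∃[ c ] ∃[ c′ ]
  (ColumnWord c × ColumnWord c′ × w ≡A (c ++ v) × w′ ≡A (c′ ++ v) × c ∼ c′)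

_≡C_ : ∀ {k} → Rel (Word k) 0ℓ
_≡C_ = Star (SymClosure KnuthMove ∪ _≡5_)

{-# OPTIONS --safe #-}
module Submission where

-- Read a word as a list of one-letter columns, each a 0/1 vector.  Two kinds of idempotent operators act on lists
-- of columns: raise moves letters between adjacent columns (a type A crystal operator applied as often as
-- possible), and cancelCol deletes pairs i , ī from the first column.  They satisfy the braid relations of type C,
-- so the composite belonging to the longest element, computed by sweeping in one column after the other,
-- absorbs each of them.  Hence the result of sweeping (up to empty columns) is unchanged by Knuth moves, which
-- are instances of raise, and by cancellation in the first column.  The only braid relation that is not of type
-- A, the one of length four, is pulled back from type A₃ along a mirror embedding.  On a King tableau all
-- operators are trivial, so sweeping its word returns its columns.  Finally, each step of Berele insertion
-- multiplies the row word by a letter up to Knuth moves and at most one cancellation in the first column.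
-- So w ≡C w′ and P-C w ≡ P-C w′ both amount to the equality of the sweeps.

open import Defs
open import Data.Bool using (Bool; true; false)
import Data.Bool.Properties as Bool
open import Data.Fin as Fin using (Fin; zero; suc; toℕ)
import Data.Fin.Properties as Fin
open import Data.List using (List; []; _∷_; _++_; _∷ʳ_; _ʳ++_; break; foldl; length; map; reverse; splitAt)
open import Data.List.Membership.Propositional using (_∈_)
open import Data.List.Membership.Propositional.Properties using (∈-++⁺ʳ)
open import Data.List.Properties using (++-assoc; ++-identityʳ; ʳ++-defn; map-++; reverse-++; reverse-injective; reverse-involutive; ∷-injective; ∷-injectiveˡ; ∷-injectiveʳ)
open import Data.List.Relation.Binary.Pointwise using (Pointwise; []; _∷_)
open import Data.List.Relation.Unary.All as All using (All; []; _∷_)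
import Data.List.Relation.Unary.All.Properties as All
open import Data.List.Relation.Unary.AllPairs using (AllPairs; []; _∷_)
open import Data.List.Relation.Unary.Any using (here)
open import Data.List.Relation.Unary.Linked as Linked using (Linked; []; [-]; _∷_)
open import Data.List.Relation.Unary.Linked.Properties using (Linked⇒AllPairs)
open import Data.Maybe using (Maybe; just; nothing)
open import Data.Nat as ℕ using (ℕ; zero; suc; _+_; _*_; _∸_; s≤s; z≤n; NonZero)
import Data.Nat.Properties as ℕ
open import Data.Product using (_×_; _,_; proj₁; proj₂; ∃)
open import Data.Sum using (inj₁; inj₂)
open import Data.Vec using (Vec; []; _∷_; replicate; lookup; _[_]≔_; fromList; toList)
open import Data.Vec.Properties using (≡-dec; lookup∘update′; lookup-replicate; lookup∘update; []≔-commutes; []≔-idempotent; []≔-lookup; toList∘fromList)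
open import Function using (_∘_)
open import Function.Bundles using (_⇔_; mk⇔)
open import Level using (0ℓ)
import Relation.Binary.Construct.Closure.Equivalence as Eq
open import Relation.Binary.Construct.Closure.ReflexiveTransitive as Star using (Star; ε; _◅_; _◅◅_; gmap)
open import Relation.Binary.Construct.Closure.Symmetric using (fwd; bwd)
open import Relation.Binary.Definitions using (tri<; tri≈; tri>)
open import Relation.Binary.PropositionalEquality using (_≡_; _≢_; refl; sym; trans; cong; cong₂; subst; subst₂; module ≡-Reasoning)
open import Relation.Nullary using (¬_; yes; no; contradiction)
open import Relation.Unary using (Pred; Decidable)

-- Crystal operators on columns

-- Under skew Howe duality a list of columns carries a second crystal, for the algebra dual to
-- sp(2k), and `raise` and `cancelCol` are maximal powers of its raising operators. In a crystal of
-- rank two, both words for the longest element lead to the highest weight vertex; this is why braid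
-- relations are to be expected although the operators are not invertible. Two equivalent words are
-- never inserted side by side. Equivalence is detected by an invariant, and insertion enters only
-- as a normalization of one word at a time. The delicate point is that a pair may be cancelled only
-- in the first column, while Berele insertion cancels deep inside a row word. The first column
-- therefore has to be split off by Knuth moves both before and after the cancellation, and what
-- remains to its right must be the same word in both cases.

raiseBit : ℕ → Bool → Bool → ℕ × Bool × Bool
raiseBit d       true  false = suc d , true , false
raiseBit d       false false = d , false , false
raiseBit zero    false true  = zero , true , false
raiseBit (suc d) false true  = d , false , true
raiseBit d       true  true  = d , true , true

-- The maximal power of the gl₂ crystal operator that moves letters from the second column to the first; d is
-- the number of unmatched letters of the first column so far.
raiseFrom : ∀ {n} → ℕ → Vec Bool n → Vec Bool n → Vec Bool n × Vec Bool n
raiseFrom d []      []      = [] , []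
raiseFrom d (a ∷ c) (b ∷ e) =
  let (d′ , a′ , b′) = raiseBit d a b
      (c′ , e′)      = raiseFrom d′ c e
  in a′ ∷ c′ , b′ ∷ e′

-- The braid relation of length three

Triple : Set → Set
Triple A = A × A × A

bits12 bits23 : ℕ → Triple Bool → ℕ × Triple Bool
bits12 d (x , y , z) = let (d′ , x′ , y′) = raiseBit d x y in d′ , x′ , y′ , z
bits23 d (x , y , z) = let (d′ , y′ , z′) = raiseBit d y z in d′ , x , y′ , z′

bits121 bits232 : Triple ℕ → Triple Bool → Triple ℕ × Triple Bool
bits121 (a , b , c) t =
  let (a′ , t₁) = bits12 a t ; (b′ , t₂) = bits23 b t₁ ; (c′ , t₃) = bits12 c t₂
  in (a′ , b′ , c′) , t₃
bits232 (a , b , c) t =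
  let (a′ , t₁) = bits23 a t ; (b′ , t₂) = bits12 b t₁ ; (c′ , t₃) = bits23 c t₂
  in (a′ , b′ , c′) , t₃

-- The piecewise linear change of coordinates (a , b , c) ↦ (b + c ∸ m , m , a + b ∸ m) with m = a ⊓ c,
-- split into its two linear pieces.
data Braided : Triple ℕ → Triple ℕ → Set where
  braidˡ : ∀ {a c′} m b s → a ≡ m + s → c′ ≡ b + s → Braided (a , b , m) (b , m , c′)
  braidʳ : ∀ {c a′} m b s → c ≡ m + s → a′ ≡ b + s → Braided (m , b , c) (a′ , m , b)

-- `Braided` is Lusztig's transition map between the two reduced words in type A₂, used here as a
-- bisimulation: the three counters are the state of each composite, and reading one bit from each
-- column keeps the states related and the outputs equal.
bits-braid : ∀ {s s′} → Braided s s′ → ∀ t →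
  let (s₁ , t₁) = bits121 s t ; (s₁′ , t₁′) = bits232 s′ t in
  t₁ ≡ t₁′ × Braided s₁ s₁′
bits-braid (braidˡ m b s refl refl) (false , false , false) = refl , braidˡ m b s refl refl
bits-braid (braidʳ m b s refl refl) (false , false , false) = refl , braidʳ m b s refl refl
bits-braid (braidˡ m b s refl refl) (true , true , true) = refl , braidˡ m b s refl refl
bits-braid (braidʳ m b s refl refl) (true , true , true) = refl , braidʳ m b s refl refl
bits-braid (braidˡ zero zero s refl refl) (false , false , true) = refl , braidˡ zero zero s refl refl
bits-braid (braidˡ m (suc b) s refl refl) (false , false , true) = refl , braidˡ m b s refl refl
bits-braid (braidˡ (suc m) zero s refl refl) (false , false , true) = refl , braidˡ m zero (suc s) (sym (ℕ.+-suc m s)) refl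
bits-braid (braidʳ zero zero zero refl refl) (false , false , true) = refl , braidʳ zero zero zero refl refl
bits-braid (braidʳ zero zero (suc s) refl refl) (false , false , true) = refl , braidʳ zero zero s refl refl
bits-braid (braidʳ m (suc b) s refl refl) (false , false , true) = refl , braidʳ m b s refl refl
bits-braid (braidʳ (suc m) zero zero refl refl) (false , false , true)
  rewrite ℕ.+-identityʳ m = refl , braidˡ m zero 1 (sym (ℕ.+-comm m 1)) refl
bits-braid (braidʳ (suc m) zero (suc s) refl refl) (false , false , true) = refl , braidʳ (suc m) zero s (ℕ.+-suc m s) refl
bits-braid (braidˡ zero b zero refl refl) (false , true , false)
  rewrite ℕ.+-identityʳ b = refl , braidʳ zero b 1 refl (sym (ℕ.+-comm b 1))
bits-braid (braidˡ zero b (suc s) refl refl) (false , true , false) = refl , braidˡ zero (suc b) s refl (ℕ.+-suc b s)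
bits-braid (braidˡ (suc m) b s refl refl) (false , true , false) = refl , braidˡ m (suc b) s refl refl
bits-braid (braidʳ zero b s refl refl) (false , true , false) = refl , braidʳ zero b (suc s) refl (sym (ℕ.+-suc b s))
bits-braid (braidʳ (suc m) b s refl refl) (false , true , false) = refl , braidʳ m (suc b) s refl refl
bits-braid (braidˡ zero zero zero refl refl) (false , true , true) = refl , braidˡ zero zero zero refl refl
bits-braid (braidˡ zero b (suc s) refl refl) (false , true , true)
  rewrite ℕ.+-suc b s = refl , braidˡ zero b s refl refl
bits-braid (braidˡ zero (suc b) zero refl refl) (false , true , true)
  rewrite ℕ.+-identityʳ b = refl , braidʳ zero b 1 refl (sym (ℕ.+-comm b 1))
bits-braid (braidˡ (suc m) b s refl refl) (false , true , true) = refl , braidˡ m b s refl refl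
bits-braid (braidʳ zero zero s refl refl) (false , true , true) = refl , braidʳ zero zero s refl refl
bits-braid (braidʳ zero (suc b) s refl refl) (false , true , true) = refl , braidʳ zero b (suc s) refl (sym (ℕ.+-suc b s))
bits-braid (braidʳ (suc m) b s refl refl) (false , true , true) = refl , braidʳ m b s refl refl
bits-braid (braidˡ m b s refl refl) (true , false , false) = refl , braidˡ (suc m) b s refl refl
bits-braid (braidʳ m b s refl refl) (true , false , false) = refl , braidʳ (suc m) b s refl refl
bits-braid (braidˡ m zero s refl refl) (true , false , true) = refl , braidˡ m zero (suc s) (sym (ℕ.+-suc m s)) refl
bits-braid (braidˡ m (suc b) s refl refl) (true , false , true) = refl , braidˡ (suc m) b s refl refl
bits-braid (braidʳ m zero zero refl refl) (true , false , true)
  rewrite ℕ.+-identityʳ m = refl , braidˡ m zero 1 (sym (ℕ.+-comm m 1)) refl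
bits-braid (braidʳ m zero (suc s) refl refl) (true , false , true) = refl , braidʳ (suc m) zero s (ℕ.+-suc m s) refl
bits-braid (braidʳ m (suc b) s refl refl) (true , false , true) = refl , braidʳ (suc m) b s refl refl
bits-braid (braidˡ m b s refl refl) (true , true , false) = refl , braidˡ m (suc b) s refl refl
bits-braid (braidʳ m b s refl refl) (true , true , false) = refl , braidʳ m (suc b) s refl refl

cols12 cols23 : ∀ {n} → ℕ → Triple (Vec Bool n) → Triple (Vec Bool n)
cols12 d (x , y , z) = let (x′ , y′) = raiseFrom d x y in x′ , y′ , z
cols23 d (x , y , z) = let (y′ , z′) = raiseFrom d y z in x , y′ , z′

consᵗ : ∀ {n} → Triple Bool → Triple (Vec Bool n) → Triple (Vec Bool (suc n))
consᵗ (x , y , z) (xs , ys , zs) = x ∷ xs , y ∷ ys , z ∷ zs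

cols-braid : ∀ {n a b c a′ b′ c′} → Braided (a , b , c) (a′ , b′ , c′) → (t : Triple (Vec Bool n)) →
  cols12 c (cols23 b (cols12 a t)) ≡ cols23 c′ (cols12 b′ (cols23 a′ t))
cols-braid r ([] , [] , []) = refl
cols-braid r (x ∷ xs , y ∷ ys , z ∷ zs) =
  let (eq , r′) = bits-braid r (x , y , z)
  in cong₂ consᵗ eq (cols-braid r′ (xs , ys , zs))

raise : ∀ {n} → Vec Bool n → Vec Bool n → Vec Bool n × Vec Bool n
raise = raiseFrom 0

-- Cancellation and the braid relation of length four

double : ℕ → ℕ
double zero    = zero
double (suc k) = suc (suc (double k))

-- The two bits of an index stand for i and ī. With `double k` in place of `2 * k`, pattern matching
-- exposes both bits of the first index.
Column : ℕ → Set
Column k = Vec Bool (double k)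

cancelSite : ℕ → Bool → Bool → ℕ × Bool × Bool
cancelSite h       false false = suc h , false , false
cancelSite h       false true  = h , false , true
cancelSite h       true  false = h , true , false
cancelSite zero    true  true  = zero , false , false
cancelSite (suc h) true  true  = h , true , true

-- The column version of Berele's cancellation: a pair i , ī that is not matched by an earlier index absent from
-- the column is deleted; h is the number of unmatched absent indices so far.
cancelFrom : ∀ {k} → ℕ → Column k → Column k
cancelFrom {zero}  h []          = []
cancelFrom {suc k} h (a ∷ b ∷ c) = let (h′ , a′ , b′) = cancelSite h a b in a′ ∷ b′ ∷ cancelFrom h′ c

cancelCol : ∀ {k} → Column k → Column k
cancelCol = cancelFrom 0

-- A type C₂ crystal embeds into a type A₃ crystal in which raise becomes raise₁ raise₃ and cancelCol becomes
-- raise₂.  The table was found by matching the two crystals on one site, that is, on the letters i and ī.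
mirrorSite : Bool → Bool → Bool → Bool → Bool × Bool × Bool × Bool
mirrorSite false false false false = true  , true  , true  , true
mirrorSite false false false true  = false , true  , true  , true
mirrorSite false false true  false = true  , false , true  , true
mirrorSite false false true  true  = false , false , true  , true
mirrorSite false true  false false = true  , true  , false , true
mirrorSite false true  false true  = true  , false , true  , false
mirrorSite false true  true  false = false , true  , true  , false
mirrorSite false true  true  true  = false , false , false , true
mirrorSite true  false false false = true  , true  , true  , false
mirrorSite true  false false true  = true  , false , true  , false
mirrorSite true  false true  false = true  , false , true  , false
mirrorSite true  false true  true  = false , false , true  , false
mirrorSite true  true  false false = true  , true  , false , false
mirrorSite true  true  false true  = false , true  , false , false
mirrorSite true  true  true  false = true  , false , false , false
mirrorSite true  true  true  true  = false , false , false , false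

raiseSite : ℕ → Bool → Bool → Bool → Bool → ℕ × Bool × Bool × Bool × Bool
raiseSite d c₁ c₂ e₁ e₂ =
  let (d₁ , c₁′ , e₁′) = raiseBit d c₁ e₁ ; (d₂ , c₂′ , e₂′) = raiseBit d₁ c₂ e₂
  in d₂ , c₁′ , c₂′ , e₁′ , e₂′

mirrorSite-raise : ∀ d c₁ c₂ e₁ e₂ →
  let (d′ , c₁′ , c₂′ , e₁′ , e₂′) = raiseSite d c₁ c₂ e₁ e₂
      (a₁ , a₂ , b₁ , b₂) = mirrorSite c₁ c₂ e₁ e₂
  in raiseSite d a₁ a₂ b₁ b₂ ≡ (d′ , mirrorSite c₁′ c₂′ e₁′ e₂′)
mirrorSite-raise d             false false false false = refl
mirrorSite-raise zero          false false false true = refl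
mirrorSite-raise (suc d)       false false false true = refl
mirrorSite-raise zero          false false true  false = refl
mirrorSite-raise (suc d)       false false true  false = refl
mirrorSite-raise zero          false false true  true = refl
mirrorSite-raise (suc zero)    false false true  true = refl
mirrorSite-raise (suc (suc d)) false false true  true = refl
mirrorSite-raise d             false true  false false = refl
mirrorSite-raise d             false true  false true = refl
mirrorSite-raise zero          false true  true  false = refl
mirrorSite-raise (suc d)       false true  true  false = refl
mirrorSite-raise zero          false true  true  true = refl
mirrorSite-raise (suc d)       false true  true  true = refl
mirrorSite-raise d             true  false false false = refl
mirrorSite-raise d             true  false false true = refl
mirrorSite-raise d             true  false true  false = refl
mirrorSite-raise zero          true  false true  true = refl
mirrorSite-raise (suc d)       true  false true  true = refl
mirrorSite-raise d             true  true  false false = refl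
mirrorSite-raise d             true  true  false true = refl
mirrorSite-raise d             true  true  true  false = refl
mirrorSite-raise d             true  true  true  true = refl

-- The counter of `raise` runs at twice the capacity: an absent index of c has both letters in the
-- mirror column, leaving two unmatched letters, and a pair i , ī uses up two. With no capacity
-- left, both letters of the pair move into the mirror column.
mirrorSite-cancel : ∀ h c₁ c₂ e₁ e₂ →
  let (h′ , c₁′ , c₂′) = cancelSite h c₁ c₂
      (a₁ , a₂ , b₁ , b₂) = mirrorSite c₁ c₂ e₁ e₂
      (a₁′ , a₂′ , b₁′ , b₂′) = mirrorSite c₁′ c₂′ e₁ e₂
  in (a₁ , a₂ , raiseSite (double h) b₁ b₂ c₁ c₂) ≡ (a₁′ , a₂′ , double h′ , b₁′ , b₂′ , c₁′ , c₂′)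
mirrorSite-cancel h       false false false false = refl
mirrorSite-cancel h       false false false true = refl
mirrorSite-cancel h       false false true  false = refl
mirrorSite-cancel h       false false true  true = refl
mirrorSite-cancel h       false true  false false = refl
mirrorSite-cancel h       false true  false true = refl
mirrorSite-cancel h       false true  true  false = refl
mirrorSite-cancel h       false true  true  true = refl
mirrorSite-cancel h       true  false false false = refl
mirrorSite-cancel h       true  false false true = refl
mirrorSite-cancel h       true  false true  false = refl
mirrorSite-cancel h       true  false true  true = refl
mirrorSite-cancel zero    true  true  false false = refl
mirrorSite-cancel (suc h) true  true  false false = refl
mirrorSite-cancel zero    true  true  false true = refl
mirrorSite-cancel (suc h) true  true  false true = refl
mirrorSite-cancel zero    true  true  true  false = refl
mirrorSite-cancel (suc h) true  true  true  false = refl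
mirrorSite-cancel zero    true  true  true  true = refl
mirrorSite-cancel (suc h) true  true  true  true = refl

mirror : ∀ {k} → Column k → Column k → Column k × Column k
mirror {zero}  []            []            = [] , []
mirror {suc k} (c₁ ∷ c₂ ∷ c) (e₁ ∷ e₂ ∷ e) =
  let (a₁ , a₂ , b₁ , b₂) = mirrorSite c₁ c₂ e₁ e₂ ; (a , b) = mirror c e
  in a₁ ∷ a₂ ∷ a , b₁ ∷ b₂ ∷ b

mirror-raise : ∀ {k} d (c e : Column k) → let (a , b) = mirror c e ; (c′ , e′) = raiseFrom d c e in
  raiseFrom d a b ≡ mirror c′ e′
mirror-raise {zero}  d [] [] = refl
mirror-raise {suc k} d (c₁ ∷ c₂ ∷ c) (e₁ ∷ e₂ ∷ e) =
  let eq = mirrorSite-raise d c₁ c₂ e₁ e₂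
      d₂ = proj₁ (raiseSite d c₁ c₂ e₁ e₂)
      (a , b) = mirror c e
  in cong₂ (λ (a₁ , a₂ , b₁ , b₂) (a , b) → a₁ ∷ a₂ ∷ a , b₁ ∷ b₂ ∷ b) (cong proj₂ eq)
       (trans (cong (λ d → raiseFrom d a b) (cong proj₁ eq)) (mirror-raise d₂ c e))

mirror-cancel : ∀ {k} h (c e : Column k) → let (a , b) = mirror c e ; c′ = cancelFrom h c in
  (a , raiseFrom (double h) b c) ≡ (proj₁ (mirror c′ e) , proj₂ (mirror c′ e) , c′)
mirror-cancel {zero}  h [] [] = refl
mirror-cancel {suc k} h (c₁ ∷ c₂ ∷ c) (e₁ ∷ e₂ ∷ e) =
  let eq = mirrorSite-cancel h c₁ c₂ e₁ e₂
      h₁ = proj₁ (cancelSite h c₁ c₂)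
      (a , b) = mirror c e
  in cong₂ (λ (a₁ , a₂ , _ , b₁ , b₂ , c₁ , c₂) (a , b , c) → a₁ ∷ a₂ ∷ a , b₁ ∷ b₂ ∷ b , c₁ ∷ c₂ ∷ c) eq
       (trans (cong (λ d → a , raiseFrom d b c) (cong (proj₁ ∘ proj₂ ∘ proj₂) eq)) (mirror-cancel h₁ c e))

Quad : Set → Set
Quad A = A × A × A × A

module _ {n : ℕ} where

  raise₁ raise₂ raise₃ : Quad (Vec Bool n) → Quad (Vec Bool n)
  raise₁ (a , b , c , e) = let (a′ , b′) = raise a b in a′ , b′ , c , e
  raise₂ (a , b , c , e) = let (b′ , c′) = raise b c in a , b′ , c′ , e
  raise₃ (a , b , c , e) = let (c′ , e′) = raise c e in a , b , c′ , e′

  raise-121 : ∀ q → raise₁ (raise₂ (raise₁ q)) ≡ raise₂ (raise₁ (raise₂ q))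
  raise-121 (a , b , c , e) =
    cong (λ (a , b , c) → a , b , c , e) (cols-braid (braidˡ 0 0 0 refl refl) (a , b , c))

  raise-232 : ∀ q → raise₂ (raise₃ (raise₂ q)) ≡ raise₃ (raise₂ (raise₃ q))
  raise-232 (a , b , c , e) = cong (a ,_) (cols-braid (braidˡ 0 0 0 refl refl) (b , c , e))

  -- Folding of A₃: both sides are reduced words of its longest element, joined by braid moves of
  -- length three. `raise₁` and `raise₃` act on disjoint columns and commute by computation, so
  -- their exchanges leave no trace in the chain.
  raise-fold : ∀ q → raise₂ (raise₁ (raise₃ (raise₂ (raise₁ (raise₃ q))))) ≡
                     raise₁ (raise₃ (raise₂ (raise₁ (raise₃ (raise₂ q)))))
  raise-fold q = begin
    raise₂ (raise₁ (raise₃ (raise₂ (raise₃ (raise₁ q))))) ≡⟨ cong (raise₂ ∘ raise₁) (raise-232 (raise₁ q)) ⟨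
    raise₂ (raise₁ (raise₂ (raise₃ (raise₂ (raise₁ q))))) ≡⟨ raise-121 (raise₃ (raise₂ (raise₁ q))) ⟨
    raise₁ (raise₂ (raise₁ (raise₃ (raise₂ (raise₁ q))))) ≡⟨ cong (raise₁ ∘ raise₂ ∘ raise₃) (raise-121 q) ⟩
    raise₁ (raise₂ (raise₃ (raise₂ (raise₁ (raise₂ q))))) ≡⟨ cong raise₁ (raise-232 (raise₁ (raise₂ q))) ⟩
    raise₁ (raise₃ (raise₂ (raise₃ (raise₁ (raise₂ q))))) ∎
    where open ≡-Reasoning

module _ {k : ℕ} where

  raiseP cancelP : Column k × Column k → Column k × Column k
  raiseP (c , e) = raise c e
  cancelP (c , e) = cancelCol c , e

  embed : Column k × Column k → Quad (Column k)
  embed (c , e) = let (a , b) = mirror c e in a , b , c , e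

  embed-raise : ∀ p → embed (raiseP p) ≡ raise₁ (raise₃ (embed p))
  embed-raise (c , e) = sym (cong (λ (a , b) → a , b , raise c e) (mirror-raise 0 c e))

  embed-cancel : ∀ p → embed (cancelP p) ≡ raise₂ (embed p)
  embed-cancel (c , e) = sym (cong (λ (a , b , c) → a , b , c , e) (mirror-cancel 0 c e))

  -- The last two components of `embed p` are p itself, so the relation is recovered by projection.
  cancel-raise-braid : ∀ p → cancelP (raiseP (cancelP (raiseP p))) ≡ raiseP (cancelP (raiseP (cancelP p)))
  cancel-raise-braid p = cong (proj₂ ∘ proj₂) (begin
    embed (cancelP (raiseP (cancelP (raiseP p))))                                    ≡⟨ embed-cancel _ ⟩
    raise₂ (embed (raiseP (cancelP (raiseP p))))                                     ≡⟨ cong raise₂ (embed-raise _) ⟩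
    raise₂ (raise₁ (raise₃ (embed (cancelP (raiseP p)))))                            ≡⟨ cong (raise₂ ∘ raise₁ ∘ raise₃) (embed-cancel _) ⟩
    raise₂ (raise₁ (raise₃ (raise₂ (embed (raiseP p)))))                             ≡⟨ cong (raise₂ ∘ raise₁ ∘ raise₃ ∘ raise₂) (embed-raise p) ⟩
    raise₂ (raise₁ (raise₃ (raise₂ (raise₁ (raise₃ (embed p))))))                    ≡⟨ raise-fold (embed p) ⟩
    raise₁ (raise₃ (raise₂ (raise₁ (raise₃ (raise₂ (embed p))))))                    ≡⟨ cong (raise₁ ∘ raise₃ ∘ raise₂ ∘ raise₁ ∘ raise₃) (embed-cancel p) ⟨
    raise₁ (raise₃ (raise₂ (raise₁ (raise₃ (embed (cancelP p))))))                   ≡⟨ cong (raise₁ ∘ raise₃ ∘ raise₂) (embed-raise _) ⟨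
    raise₁ (raise₃ (raise₂ (embed (raiseP (cancelP p)))))                            ≡⟨ cong (raise₁ ∘ raise₃) (embed-cancel _) ⟨
    raise₁ (raise₃ (embed (cancelP (raiseP (cancelP p)))))                           ≡⟨ embed-raise _ ⟨
    embed (raiseP (cancelP (raiseP (cancelP p))))                                    ∎)
    where open ≡-Reasoning

-- A letter moved to the first column counts as unmatched there in the second pass, so the second
-- counter is ahead by the number r of letters moved so far.
raiseFrom-idem : ∀ {n} d r (c e : Vec Bool n) → let (c′ , e′) = raiseFrom d c e in
  raiseFrom (d + r) c′ e′ ≡ (c′ , e′)
raiseFrom-idem d r [] [] = refl
raiseFrom-idem d r (false ∷ c) (false ∷ e) = cong (λ (c , e) → false ∷ c , false ∷ e) (raiseFrom-idem d r c e)
raiseFrom-idem zero r (false ∷ c) (true ∷ e) = cong (λ (c , e) → true ∷ c , false ∷ e) (raiseFrom-idem zero (suc r) c e)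
raiseFrom-idem (suc d) r (false ∷ c) (true ∷ e) = cong (λ (c , e) → false ∷ c , true ∷ e) (raiseFrom-idem d r c e)
raiseFrom-idem d r (true ∷ c) (false ∷ e) = cong (λ (c , e) → true ∷ c , false ∷ e) (raiseFrom-idem (suc d) r c e)
raiseFrom-idem d r (true ∷ c) (true ∷ e) = cong (λ (c , e) → true ∷ c , true ∷ e) (raiseFrom-idem d r c e)

-- A deleted pair leaves an absent index, so r is the number of pairs deleted so far.
cancelFrom-idem : ∀ {k} h r (c : Column k) → cancelFrom (h + r) (cancelFrom h c) ≡ cancelFrom h c
cancelFrom-idem {zero} h r [] = refl
cancelFrom-idem {suc k} h r (false ∷ false ∷ c) = cong (λ c → false ∷ false ∷ c) (cancelFrom-idem (suc h) r c)
cancelFrom-idem {suc k} h r (false ∷ true ∷ c) = cong (λ c → false ∷ true ∷ c) (cancelFrom-idem h r c)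
cancelFrom-idem {suc k} h r (true ∷ false ∷ c) = cong (λ c → true ∷ false ∷ c) (cancelFrom-idem h r c)
cancelFrom-idem {suc k} zero r (true ∷ true ∷ c) = cong (λ c → false ∷ false ∷ c) (cancelFrom-idem zero (suc r) c)
cancelFrom-idem {suc k} (suc h) r (true ∷ true ∷ c) = cong (λ c → true ∷ true ∷ c) (cancelFrom-idem h r c)

under : ∀ {A : Set} {m} → (Vec A m → Vec A m) → Vec A (suc m) → Vec A (suc m)
under f (x ∷ v) = x ∷ f v

∅ : ∀ {n} → Vec Bool n
∅ = replicate _ false

raiseFrom-∅ʳ : ∀ {n} d (c : Vec Bool n) → raiseFrom d c ∅ ≡ (c , ∅)
raiseFrom-∅ʳ d [] = refl
raiseFrom-∅ʳ d (false ∷ c) = cong (λ (c , e) → false ∷ c , false ∷ e) (raiseFrom-∅ʳ d c)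
raiseFrom-∅ʳ d (true ∷ c) = cong (λ (c , e) → true ∷ c , false ∷ e) (raiseFrom-∅ʳ (suc d) c)

raise-∅ˡ : ∀ {n} (c : Vec Bool n) → raise ∅ c ≡ (c , ∅)
raise-∅ˡ [] = refl
raise-∅ˡ (false ∷ c) = cong (λ (c , e) → false ∷ c , false ∷ e) (raise-∅ˡ c)
raise-∅ˡ (true ∷ c) = cong (λ (c , e) → true ∷ c , false ∷ e) (raise-∅ˡ c)

-- Sweeping and absorption

module _ {k : ℕ} where

  Columns : ℕ → Set
  Columns = Vec (Column k)

  -- Lists of columns are written from right to left.
  adjoin : ∀ {m} → Columns (suc (suc m)) → Columns (suc (suc m))
  adjoin (x ∷ c ∷ v) = let (c′ , x′) = raise c x in x′ ∷ c′ ∷ v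

  -- A reduced word for the sign change of the newest coordinate. Applied after a longest word of
  -- type C on the earlier columns, it gives a longest word for one column more: the lengths 1, 3,
  -- 5, ... add up to n² for n columns.
  sweep : ∀ {m} → Columns (suc m) → Columns (suc m)
  sweep {zero}  (c ∷ []) = cancelCol c ∷ []
  sweep {suc m} v        = adjoin (under sweep (adjoin v))

  adjoin-idem : ∀ {m} (v : Columns (suc (suc m))) → adjoin (adjoin v) ≡ adjoin v
  adjoin-idem (x ∷ c ∷ v) = cong (λ (c , x) → x ∷ c ∷ v) (raiseFrom-idem 0 0 c x)

  adjoin-braid : ∀ {m} (v : Columns (suc (suc (suc m)))) →
    adjoin (under adjoin (adjoin v)) ≡ under adjoin (adjoin (under adjoin v))
  adjoin-braid (x ∷ c ∷ d ∷ v) =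
    cong (λ (d , c , x) → x ∷ c ∷ d ∷ v) (sym (cols-braid (braidˡ 0 0 0 refl refl) (d , c , x)))

  adjoin-under² : ∀ {m} (f : Columns m → Columns m) (v : Columns (suc (suc m))) →
    adjoin (under (under f) v) ≡ under (under f) (adjoin v)
  adjoin-under² f (x ∷ c ∷ v) = refl

  -- The shorter sweep takes the part of `cancelCol`: in the Weyl group, the sign change of a
  -- coordinate and the exchange of that coordinate with the next satisfy the same relation. With
  -- the shorter sweep written as B W B, the relation follows from braids of length three, the
  -- commutation of A with W and induction, without idempotence.
  sweep-braid : ∀ {m} (v : Columns (suc (suc m))) →
    adjoin (under sweep (adjoin (under sweep v))) ≡ under sweep (adjoin (under sweep (adjoin v)))
  sweep-braid {zero} (x ∷ c ∷ []) = cong (λ (c , x) → x ∷ c ∷ []) (sym (cancel-raise-braid (c , x)))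
  sweep-braid {suc m} v = begin
    A (U v₁)                                  ≡⟨ cong A (split v₁) ⟩
    A (B (W (B (A (U v)))))                   ≡⟨ cong (A ∘ B ∘ W ∘ B ∘ A) (split v) ⟩
    A (B (W (B (A (B (W (B v)))))))           ≡⟨ cong (A ∘ B ∘ W) (adjoin-braid (W (B v))) ⟨
    A (B (W (A (B (A (W (B v)))))))           ≡⟨ cong (A ∘ B ∘ W ∘ A ∘ B) (adjoin-under² sweep (B v)) ⟩
    A (B (W (A (B (W (A (B v)))))))           ≡⟨ cong (A ∘ B) (adjoin-under² sweep (B (W (A (B v))))) ⟨
    A (B (A (W (B (W (A (B v)))))))           ≡⟨ adjoin-braid (W (B (W (A (B v))))) ⟩
    B (A (B (W (B (W (A (B v)))))))           ≡⟨ cong (B ∘ A) (inner (A (B v))) ⟩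
    B (A (W (B (W (B (A (B v)))))))           ≡⟨ cong (B ∘ A ∘ W ∘ B ∘ W) (adjoin-braid v) ⟨
    B (A (W (B (W (A (B (A v)))))))           ≡⟨ cong B (adjoin-under² sweep (B (W (A (B (A v)))))) ⟩
    B (W (A (B (W (A (B (A v)))))))           ≡⟨ cong (B ∘ W ∘ A ∘ B) (adjoin-under² sweep (B (A v))) ⟨
    B (W (A (B (A (W (B (A v)))))))           ≡⟨ cong (B ∘ W) (adjoin-braid (W (B (A v)))) ⟩
    B (W (B (A (B (W (B (A v)))))))           ≡⟨ cong (B ∘ W ∘ B ∘ A) (split (A v)) ⟨
    B (W (B (A (U (A v)))))                   ≡⟨ split (A (U (A v))) ⟨
    U (A (U (A v)))                           ∎
    where
    open ≡-Reasoning
    A B W U : Columns (suc (suc (suc m))) → Columns (suc (suc (suc m)))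
    A = adjoin
    B = under adjoin
    W = under (under sweep)
    U = under sweep
    v₁ = A (U v)
    split : ∀ v → U v ≡ B (W (B v))
    split (x ∷ v) = refl
    inner : ∀ v → B (W (B (W v))) ≡ W (B (W (B v)))
    inner (x ∷ v) = cong (x ∷_) (sweep-braid v)

  -- A U A U is a longest word in A and U. A further A applied before it is carried to the other end
  -- by the braid relation, where idempotence removes it.
  sweep-adjoin : ∀ {m} (v : Columns (suc (suc m))) → sweep (under sweep (adjoin v)) ≡ sweep (under sweep v)
  sweep-adjoin v = begin
    A (U (A (U (A v))))  ≡⟨ cong A (sweep-braid v) ⟨
    A (A (U (A (U v))))  ≡⟨ adjoin-idem _ ⟩
    A (U (A (U v)))      ∎
    where
    open ≡-Reasoning
    A = adjoin
    U = under sweep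

  sweepAll : (cs : List (Column k)) → Columns (length cs)
  sweepAll []       = []
  sweepAll (c ∷ cs) = sweep (c ∷ sweepAll cs)

  -- The extra `adjoin` is absorbed as in `sweep-adjoin`; what is left over is a second sweep of the
  -- shorter list, which induction removes.
  sweepAll-fixed : ∀ c cs → sweep (sweepAll (c ∷ cs)) ≡ sweepAll (c ∷ cs)
  sweepAll-fixed c [] = cong (_∷ []) (cancelFrom-idem 0 0 c)
  sweepAll-fixed c (d ∷ cs) = begin
    A (U (A (A (U (A v)))))  ≡⟨ cong (A ∘ U) (adjoin-idem _) ⟩
    A (U (A (U (A v))))      ≡⟨ cong A (sweep-braid v) ⟨
    A (A (U (A (U v))))      ≡⟨ adjoin-idem _ ⟩
    A (U (A (U v)))          ≡⟨ cong (A ∘ U ∘ A) (cong (c ∷_) (sweepAll-fixed d cs)) ⟩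
    A (U (A v))              ∎
    where
    open ≡-Reasoning
    A = adjoin
    U = under sweep
    v = c ∷ sweepAll (d ∷ cs)

  adjoin-∅ : ∀ {m} (v : Columns (suc m)) → adjoin (∅ ∷ v) ≡ ∅ ∷ v
  adjoin-∅ (c ∷ v) = cong (λ (c , x) → x ∷ c ∷ v) (raiseFrom-∅ʳ 0 c)

  -- The first `adjoin` moves c into the empty place and leaves the empty column at the head of the
  -- list, where the last `adjoin` keeps it. So empty columns collect at the right end and may be
  -- trimmed before a sweep.
  sweep-∅ : ∀ {m} c (v : Columns m) → sweep (c ∷ ∅ ∷ v) ≡ ∅ ∷ sweep (c ∷ v)
  sweep-∅ c v = trans (cong (adjoin ∘ under sweep) (cong (λ (c , x) → x ∷ c ∷ v) (raise-∅ˡ c))) (adjoin-∅ _)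

  trim : ∀ {m} → Columns m → ∃ Columns
  trim []      = _ , []
  trim (c ∷ v) with ≡-dec Bool._≟_ c ∅
  ... | yes _ = trim v
  ... | no  _ = _ , c ∷ v

  trim-∅ : ∀ {m} (v : Columns m) → trim (∅ ∷ v) ≡ trim v
  trim-∅ v with ≡-dec Bool._≟_ (∅ {double k}) ∅
  ... | yes _   = refl
  ... | no  ∅≢∅ = contradiction refl ∅≢∅

  trim-sweep : ∀ {m} c (v : Columns m) → trim (sweep (c ∷ v)) ≡ trim (sweep (c ∷ proj₂ (trim v)))
  trim-sweep c [] = refl
  trim-sweep c (e ∷ v) with ≡-dec Bool._≟_ e ∅
  ... | yes refl = trans (cong trim (sweep-∅ c v)) (trans (trim-∅ (sweep (c ∷ v))) (trim-sweep c v))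
  ... | no  _    = refl

  -- Empty columns record cancelled letters and are ignored.
  core : List (Column k) → ∃ Columns
  core cs = trim (sweepAll cs)

  infix 4 _≈_

  record _≈_ (cs cs′ : List (Column k)) : Set where
    constructor same
    field cores : core cs ≡ core cs′

  ≈-refl : ∀ {cs} → cs ≈ cs
  ≈-refl = same refl

  ≈-sym : ∀ {cs cs′} → cs ≈ cs′ → cs′ ≈ cs
  ≈-sym (same eq) = same (sym eq)

  ≈-trans : ∀ {cs cs′ cs″} → cs ≈ cs′ → cs′ ≈ cs″ → cs ≈ cs″
  ≈-trans (same eq) (same eq′) = same (trans eq eq′)

  ≈-∷ : ∀ c {cs cs′} → cs ≈ cs′ → c ∷ cs ≈ c ∷ cs′
  ≈-∷ c {cs} {cs′} (same eq) = same (begin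
    core (c ∷ cs)                          ≡⟨ trim-sweep c (sweepAll cs) ⟩
    trim (sweep (c ∷ proj₂ (core cs)))     ≡⟨ cong (λ p → trim (sweep (c ∷ proj₂ p))) eq ⟩
    trim (sweep (c ∷ proj₂ (core cs′)))    ≡⟨ trim-sweep c (sweepAll cs′) ⟨
    core (c ∷ cs′)                         ∎)
    where open ≡-Reasoning

  ≈-++ : ∀ ds {cs cs′} → cs ≈ cs′ → ds ++ cs ≈ ds ++ cs′
  ≈-++ []       eq = eq
  ≈-++ (d ∷ ds) eq = ≈-∷ d (≈-++ ds eq)

  ≈-raise : ∀ x c {c′ x′} cs → raise c x ≡ (c′ , x′) → x ∷ c ∷ cs ≈ x′ ∷ c′ ∷ cs
  ≈-raise x c cs refl = same (cong trim (sym (sweep-adjoin (x ∷ c ∷ sweepAll cs))))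

  ≈-∅ : ∀ cs → ∅ ∷ cs ≈ cs
  ≈-∅ [] = same (trans (cong (λ c → trim (c ∷ [])) (cancel-∅ 0)) (trim-∅ []))
    where
    cancel-∅ : ∀ {k} h → cancelFrom {k} h (replicate _ false) ≡ replicate _ false
    cancel-∅ {zero}  h = refl
    cancel-∅ {suc k} h = cong (λ c → false ∷ false ∷ c) (cancel-∅ (suc h))
  ≈-∅ (c ∷ cs) = same (begin
    trim (adjoin (under sweep (adjoin (∅ ∷ v))))  ≡⟨ cong (trim ∘ adjoin ∘ under sweep) (adjoin-∅ v) ⟩
    trim (adjoin (∅ ∷ sweep v))                   ≡⟨ cong (trim ∘ adjoin ∘ (∅ ∷_)) (sweepAll-fixed c cs) ⟩
    trim (adjoin (∅ ∷ v))                         ≡⟨ cong trim (adjoin-∅ v) ⟩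
    trim (∅ ∷ v)                                  ≡⟨ trim-∅ v ⟩
    trim v                                        ∎)
    where
    open ≡-Reasoning
    v = sweepAll (c ∷ cs)

  -- Restricted to one column because `cancelCol` acts on the leftmost column only; `≈-++` adds
  -- columns on the right afterwards.
  ≈-cancel : ∀ c {c′} → cancelCol c ≡ c′ → c ∷ [] ≈ c′ ∷ []
  ≈-cancel c refl = same (cong (λ c → trim (c ∷ [])) (sym (cancelFrom-idem 0 0 c)))

-- Words as lists of columns

single : ∀ {n} → Fin n → Vec Bool n
single x = ∅ [ x ]≔ true

-- The emptied column disappears under `≈`, so this glues a letter to a column of larger letters.
raise-below : ∀ {n} (e : Vec Bool n) x → (∀ i → i Fin.≤ x → lookup e i ≡ false) →
  raise e (single x) ≡ (e [ x ]≔ true , ∅)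
raise-below (false ∷ e) zero    low = cong (λ (c , e) → true ∷ c , false ∷ e) (raiseFrom-∅ʳ 0 e)
raise-below (false ∷ e) (suc x) low =
  cong (λ (c , e) → false ∷ c , false ∷ e) (raise-below e x λ i i≤x → low (suc i) (s≤s i≤x))
raise-below (true ∷ e)  x       low = contradiction (low zero z≤n) λ ()

single-low : ∀ {n} {x y : Fin n} → x Fin.< y → ∀ i → i Fin.≤ x → lookup (single y) i ≡ false
single-low {x = x} {y} x<y i i≤x =
  trans (lookup∘update′ (λ i≡y → ℕ.<⇒≢ (ℕ.≤-<-trans i≤x x<y) (cong toℕ i≡y)) ∅ true) (lookup-replicate i false)

raise-∅-single : ∀ {n} d (z : Fin n) → raiseFrom (suc d) ∅ (single z) ≡ (∅ , single z)
raise-∅-single d zero    = cong (λ (c , e) → false ∷ c , true ∷ e) (raiseFrom-∅ʳ d ∅)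
raise-∅-single d (suc z) = cong (λ (c , e) → false ∷ c , false ∷ e) (raise-∅-single d z)

raise-singles : ∀ {n} d {y z : Fin n} → y Fin.≤ z → raiseFrom d (single y) (single z) ≡ (single y , single z)
raise-singles d {zero}  {zero}  _         = cong (λ (c , e) → true ∷ c , true ∷ e) (raiseFrom-∅ʳ d ∅)
raise-singles d {zero}  {suc z} _         = cong (λ (c , e) → true ∷ c , false ∷ e) (raise-∅-single d z)
raise-singles d {suc y} {suc z} (s≤s y≤z) = cong (λ (c , e) → false ∷ c , false ∷ e) (raise-singles d y≤z)

raise-pairˡ : ∀ {n} {x y z : Fin n} → x Fin.< y → y Fin.≤ z →
  raise (single y) (single z [ x ]≔ true) ≡ (single y [ x ]≔ true , single z)
raise-pairˡ {x = zero}  {suc y} {suc z} _         (s≤s y≤z) = cong (λ (c , e) → true ∷ c , false ∷ e) (raise-singles 0 y≤z)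
raise-pairˡ {x = suc x} {suc y} {suc z} (s≤s x<y) (s≤s y≤z) = cong (λ (c , e) → false ∷ c , false ∷ e) (raise-pairˡ x<y y≤z)

raise-∅-pair : ∀ {n} {y z : Fin n} → y Fin.< z →
  raiseFrom 1 ∅ (single z [ y ]≔ true) ≡ (single z , single y)
raise-∅-pair {y = zero}  {suc z} _         = cong (λ (c , e) → false ∷ c , true ∷ e) (raise-∅ˡ (single z))
raise-∅-pair {y = suc y} {suc z} (s≤s y<z) = cong (λ (c , e) → false ∷ c , false ∷ e) (raise-∅-pair y<z)

raise-pairʳ : ∀ {n} {x y z : Fin n} → x Fin.≤ y → y Fin.< z →
  raise (single x) (single z [ y ]≔ true) ≡ (single z [ x ]≔ true , single y)
raise-pairʳ {x = zero}  {zero}  {suc z} _         _         = cong (λ (c , e) → true ∷ c , true ∷ e) (raise-∅ˡ (single z))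
raise-pairʳ {x = zero}  {suc y} {suc z} _         (s≤s y<z) = cong (λ (c , e) → true ∷ c , false ∷ e) (raise-∅-pair y<z)
raise-pairʳ {x = suc x} {suc y} {suc z} (s≤s x≤y) (s≤s y<z) = cong (λ (c , e) → false ∷ c , false ∷ e) (raise-pairʳ x≤y y<z)

pos : ∀ {k} → Letter k → Fin (double k)
pos (plain zero)    = zero
pos (bar zero)      = suc zero
pos (plain (suc i)) = suc (suc (pos (plain i)))
pos (bar (suc i))   = suc (suc (pos (bar i)))

toℕ-pos : ∀ {k} (x : Letter k) → toℕ (pos x) ≡ rank x
toℕ-pos (plain zero)    = refl
toℕ-pos (bar zero)      = refl
toℕ-pos (plain (suc i)) = trans (cong (λ n → suc (suc n)) (toℕ-pos (plain i))) (sym (ℕ.*-suc 2 (toℕ i)))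
toℕ-pos (bar (suc i))   = trans (cong (λ n → suc (suc n)) (toℕ-pos (bar i))) (cong (_+ 1) (sym (ℕ.*-suc 2 (toℕ i))))

pos-injective : ∀ {k} {x y : Letter k} → pos x ≡ pos y → x ≡ y
pos-injective {x = plain zero}    {plain zero}    _  = refl
pos-injective {x = plain (suc i)} {plain (suc j)} eq with refl ← pos-injective {x = plain i} {plain j} (Fin.suc-injective (Fin.suc-injective eq)) = refl
pos-injective {x = plain (suc i)} {bar (suc j)}   eq with () ← pos-injective {x = plain i} {bar j} (Fin.suc-injective (Fin.suc-injective eq))
pos-injective {x = plain zero}    {bar zero}      ()
pos-injective {x = plain zero}    {bar (suc _)}   ()
pos-injective {x = bar zero}      {plain zero}    ()
pos-injective {x = bar zero}      {plain (suc _)} ()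
pos-injective {x = bar zero}      {bar zero}      _  = refl
pos-injective {x = bar (suc i)}   {plain (suc j)} eq with () ← pos-injective {x = bar i} {plain j} (Fin.suc-injective (Fin.suc-injective eq))
pos-injective {x = bar (suc i)}   {bar (suc j)}   eq with refl ← pos-injective {x = bar i} {bar j} (Fin.suc-injective (Fin.suc-injective eq)) = refl

pos-< : ∀ {k} {x y : Letter k} → x < y → pos x Fin.< pos y
pos-< {x = x} {y} = subst₂ ℕ._<_ (sym (toℕ-pos x)) (sym (toℕ-pos y))

pos-≤ : ∀ {k} {x y : Letter k} → x ≤ y → pos x Fin.≤ pos y
pos-≤ {x = x} {y} = subst₂ ℕ._≤_ (sym (toℕ-pos x)) (sym (toℕ-pos y))

-- Sweeping appends a column on the right at the head of the list, so words are read backwards.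
code : ∀ {k} → Word k → List (Column k)
code w = map (single ∘ pos) (reverse w)

code-++ : ∀ {k} (u v : Word k) → code (u ++ v) ≡ code v ++ code u
code-++ u v = trans (cong (map _) (reverse-++ u v)) (map-++ _ (reverse v) (reverse u))

≈-++ʷ : ∀ {k} {u u′ : Word k} v → code u ≈ code u′ → code (u ++ v) ≈ code (u′ ++ v)
≈-++ʷ {u = u} {u′} v eq = subst₂ _≈_ (sym (code-++ u v)) (sym (code-++ u′ v)) (≈-++ (code v) eq)

code-three : ∀ {k} u v {a b c : Letter k} →
  code v ++ single (pos c) ∷ single (pos b) ∷ single (pos a) ∷ code u ≡ code (u ++ a ∷ b ∷ c ∷ v)
code-three u v {a} {b} {c} = trans (sym (trans (cong (_++ code u) (code-++ (a ∷ b ∷ c ∷ []) v)) (++-assoc (code v) _ (code u))))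
                              (sym (code-++ u (a ∷ b ∷ c ∷ v)))

-- Both words reach the columns of the three-box tableau of their class: {x , y} and then {z} in the
-- first case, {x , z} and then {y} in the second. On the side where the last two letters form a
-- column, `raise-pairˡ` or `raise-pairʳ` moves one of them to the left.
≈-knuth : ∀ {k} {w w′ : Word k} → KnuthMove w w′ → code w ≈ code w′
≈-knuth (yxz→yzx u v {x} {y} {z} x<y y≤z) =
  subst₂ _≈_ (code-three u v) (code-three u v) (≈-++ (code v) (≈-trans
    (≈-trans (≈-∷ Z (≈-raise X Y (code u) (raise-below _ _ (single-low (pos-< {x = x} {y} x<y)))))
             (≈-raise Z ∅ _ (raise-∅ˡ Z)))
    (≈-sym (≈-trans (≈-raise X Z (Y ∷ code u) (raise-below _ _ (single-low (pos-< {x = x} {z} (ℕ.<-≤-trans x<y y≤z)))))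
             (≈-∷ ∅ (≈-raise _ Y (code u) (raise-pairˡ (pos-< {x = x} {y} x<y) (pos-≤ {x = y} {z} y≤z))))))))
  where
  X = single (pos x)
  Y = single (pos y)
  Z = single (pos z)
≈-knuth (xzy→zxy u v {x} {y} {z} x≤y y<z) =
  subst₂ _≈_ (code-three u v) (code-three u v) (≈-++ (code v) (≈-trans
    (≈-trans (≈-raise Y Z (X ∷ code u) (raise-below _ _ (single-low (pos-< {x = y} {z} y<z))))
             (≈-∷ ∅ (≈-raise _ X (code u) (raise-pairʳ (pos-≤ {x = x} {y} x≤y) (pos-< {x = y} {z} y<z)))))
    (≈-sym (≈-trans (≈-∷ Y (≈-raise X Z (code u) (raise-below _ _ (single-low (pos-< {x = x} {z} (ℕ.≤-<-trans x≤y y<z))))))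
             (≈-raise Y ∅ _ (raise-∅ˡ Y))))))
  where
  X = single (pos x)
  Y = single (pos y)
  Z = single (pos z)

≈-≡A : ∀ {k} {w w′ : Word k} → w ≡A w′ → code w ≈ code w′
≈-≡A ε             = ≈-refl
≈-≡A (fwd m ◅ eq) = ≈-trans (≈-knuth m) (≈-≡A eq)
≈-≡A (bwd m ◅ eq) = ≈-trans (≈-sym (≈-knuth m)) (≈-≡A eq)

-- Columns as words and the fixed points of the operators

Ascending : ∀ {k} → Word k → Set
Ascending = AllPairs _<_

indicator : ∀ {k} → Word k → Column k
indicator []      = ∅
indicator (x ∷ c) = indicator c [ pos x ]≔ true

indicator-avoids : ∀ {k} {c : Word k} {i} → All (λ y → i ≢ pos y) c → lookup (indicator c) i ≡ false
indicator-avoids {i = i} []                       = lookup-replicate i false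
indicator-avoids {c = _ ∷ c} (i≢y ∷ i≢c) = trans (lookup∘update′ i≢y (indicator c) true) (indicator-avoids i≢c)

<⇒pos≢ : ∀ {k} {x y : Letter k} → x < y → pos x ≢ pos y
<⇒pos≢ x<y eq with refl ← pos-injective eq = ℕ.<-irrefl refl x<y

indicator-below : ∀ {k} {c : Word k} {x} → All (x <_) c → lookup (indicator c) (pos x) ≡ false
indicator-below {x = x} x<c = indicator-avoids (All.map (λ {y} → <⇒pos≢ {x = x} {y}) x<c)

≈-column : ∀ {k} {c : Word k} (R : List (Column k)) → Ascending c → map (single ∘ pos) c ++ R ≈ indicator c ∷ R
≈-column R []                       = ≈-sym (≈-∅ R)
≈-column {c = x ∷ c} R (x<c ∷ asc) = ≈-trans (≈-∷ _ (≈-column R asc))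
  (≈-trans (≈-raise (single (pos x)) (indicator c) R (raise-below _ (pos x) below)) (≈-∅ _))
  where
  below : ∀ i → i Fin.≤ pos x → lookup (indicator c) i ≡ false
  below i i≤x = indicator-avoids (All.map (λ {y} x<y i≡y →
    ℕ.<⇒≢ (ℕ.≤-<-trans i≤x (pos-< {x = x} {y} x<y)) (cong toℕ i≡y)) x<c)

count : ∀ {n} → Vec Bool n → ℕ → ℕ
count []          _       = 0
count (_ ∷ _)     zero    = 0
count (false ∷ v) (suc l) = count v l
count (true ∷ v)  (suc l) = suc (count v l)

count-0 : ∀ {n} (c : Vec Bool n) → count c 0 ≡ 0
count-0 []      = refl
count-0 (_ ∷ _) = refl

-- A ballot condition: at every position the letters of e outnumber those of c by at most the stock
-- d, so each of them finds a partner and none moves.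
raiseFrom-fixed : ∀ {n} d (c e : Vec Bool n) → (∀ l → count e l ℕ.≤ d + count c l) → raiseFrom d c e ≡ (c , e)
raiseFrom-fixed d [] [] _ = refl
raiseFrom-fixed d (false ∷ c) (false ∷ e) h = cong (λ (c , e) → false ∷ c , false ∷ e) (raiseFrom-fixed d c e (h ∘ suc))
raiseFrom-fixed zero (false ∷ c) (true ∷ e) h with () ← subst (1 ℕ.≤_) (count-0 c) (ℕ.≤-trans (s≤s z≤n) (h 1))
raiseFrom-fixed (suc d) (false ∷ c) (true ∷ e) h =
  cong (λ (c , e) → false ∷ c , true ∷ e) (raiseFrom-fixed d c e λ l → ℕ.s≤s⁻¹ (h (suc l)))
raiseFrom-fixed d (true ∷ c) (false ∷ e) h =
  cong (λ (c , e) → true ∷ c , false ∷ e)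
    (raiseFrom-fixed (suc d) c e λ l → ℕ.≤-trans (h (suc l)) (ℕ.≤-reflexive (ℕ.+-suc d _)))
raiseFrom-fixed d (true ∷ c) (true ∷ e) h =
  cong (λ (c , e) → true ∷ c , true ∷ e)
    (raiseFrom-fixed d c e λ l → ℕ.s≤s⁻¹ (ℕ.≤-trans (h (suc l)) (ℕ.≤-reflexive (ℕ.+-suc d _))))

-- The letters among the first j indices number j plus the pairs minus the absent indices, so the
-- bound says that the pairs never exceed the capacity.
cancelFrom-fixed : ∀ {k} h (c : Column k) → (∀ j → count c (double j) ℕ.≤ h + j) → cancelFrom h c ≡ c
cancelFrom-fixed {zero} h [] _ = refl
cancelFrom-fixed {suc k} h (false ∷ false ∷ c) f =
  cong (λ c → false ∷ false ∷ c) (cancelFrom-fixed (suc h) c λ j → ℕ.≤-trans (f (suc j)) (ℕ.≤-reflexive (ℕ.+-suc h j)))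
cancelFrom-fixed {suc k} h (false ∷ true ∷ c) f =
  cong (λ c → false ∷ true ∷ c) (cancelFrom-fixed h c λ j → ℕ.s≤s⁻¹ (ℕ.≤-trans (f (suc j)) (ℕ.≤-reflexive (ℕ.+-suc h j))))
cancelFrom-fixed {suc k} h (true ∷ false ∷ c) f =
  cong (λ c → true ∷ false ∷ c) (cancelFrom-fixed h c λ j → ℕ.s≤s⁻¹ (ℕ.≤-trans (f (suc j)) (ℕ.≤-reflexive (ℕ.+-suc h j))))
cancelFrom-fixed {suc k} zero (true ∷ true ∷ c) f with s≤s () ← f 1
cancelFrom-fixed {suc k} (suc h) (true ∷ true ∷ c) f =
  cong (λ c → true ∷ true ∷ c) (cancelFrom-fixed h c λ j →
    ℕ.s≤s⁻¹ (ℕ.≤-trans (ℕ.s≤s⁻¹ (f (suc j))) (ℕ.≤-reflexive (ℕ.+-suc h j))))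

-- The capacity h is used up by the letters before i, so the pair at i is the first one to cancel.
cancelFrom-pair : ∀ {k} h (i : Fin k) (c : Column k) →
  (∀ j → count c (double j) ℕ.≤ h + j) → count c (double (toℕ i)) ≡ h + toℕ i →
  lookup c (pos (plain i)) ≡ true → lookup c (pos (bar i)) ≡ false →
  cancelFrom h (c [ pos (bar i) ]≔ true) ≡ c [ pos (plain i) ]≔ false
cancelFrom-pair zero zero (true ∷ false ∷ c) f _ _ _ =
  cong (λ c → false ∷ false ∷ c) (cancelFrom-fixed zero c λ j → ℕ.s≤s⁻¹ (f (suc j)))
cancelFrom-pair h (suc i) (false ∷ false ∷ c) f eq p b =
  cong (λ c → false ∷ false ∷ c) (cancelFrom-pair (suc h) i c
    (λ j → ℕ.≤-trans (f (suc j)) (ℕ.≤-reflexive (ℕ.+-suc h j))) (trans eq (ℕ.+-suc h _)) p b)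
cancelFrom-pair h (suc i) (false ∷ true ∷ c) f eq p b =
  cong (λ c → false ∷ true ∷ c) (cancelFrom-pair h i c
    (λ j → ℕ.s≤s⁻¹ (ℕ.≤-trans (f (suc j)) (ℕ.≤-reflexive (ℕ.+-suc h j)))) (ℕ.suc-injective (trans eq (ℕ.+-suc h _))) p b)
cancelFrom-pair h (suc i) (true ∷ false ∷ c) f eq p b =
  cong (λ c → true ∷ false ∷ c) (cancelFrom-pair h i c
    (λ j → ℕ.s≤s⁻¹ (ℕ.≤-trans (f (suc j)) (ℕ.≤-reflexive (ℕ.+-suc h j)))) (ℕ.suc-injective (trans eq (ℕ.+-suc h _))) p b)
cancelFrom-pair zero (suc i) (true ∷ true ∷ c) f eq p b with s≤s () ← f 1
cancelFrom-pair (suc h) (suc i) (true ∷ true ∷ c) f eq p b =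
  cong (λ c → true ∷ true ∷ c) (cancelFrom-pair h i c
    (λ j → ℕ.s≤s⁻¹ (ℕ.≤-trans (ℕ.s≤s⁻¹ (f (suc j))) (ℕ.≤-reflexive (ℕ.+-suc h j))))
    (ℕ.suc-injective (trans (ℕ.suc-injective eq) (ℕ.+-suc h _))) p b)

ind< : ℕ → ℕ → ℕ
ind< _ zero  = 0
ind< zero (suc _) = 1
ind< (suc m) (suc n) = ind< m n

ind<-antitone : ∀ {m n} l → m ℕ.≤ n → ind< n l ℕ.≤ ind< m l
ind<-antitone                 zero    _         = z≤n
ind<-antitone {zero}  {zero}  (suc l) _         = ℕ.≤-refl
ind<-antitone {zero}  {suc n} (suc l) _         = ind<≤1 n l
  where
  ind<≤1 : ∀ m n → ind< m n ℕ.≤ 1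
  ind<≤1 _       zero    = z≤n
  ind<≤1 zero    (suc _) = ℕ.≤-refl
  ind<≤1 (suc m) (suc n) = ind<≤1 m n
ind<-antitone {suc m} {suc n} (suc l) (s≤s m≤n) = ind<-antitone l m≤n

ind<-yes : ∀ {m l} → m ℕ.< l → ind< m l ≡ 1
ind<-yes {zero}  (s≤s _)   = refl
ind<-yes {suc m} (s≤s m<l) = ind<-yes m<l

ind<-no : ∀ {m l} → l ℕ.≤ m → ind< m l ≡ 0
ind<-no z≤n       = refl
ind<-no (s≤s l≤m) = ind<-no l≤m

count-set : ∀ {n} (v : Vec Bool n) i l → lookup v i ≡ false → count (v [ i ]≔ true) l ≡ ind< (toℕ i) l + count v l
count-set (_ ∷ _)     zero    zero    _ = refl
count-set (_ ∷ _)     (suc i) zero    _ = refl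
count-set (false ∷ v) zero    (suc l) _ = refl
count-set (false ∷ v) (suc i) (suc l) p = count-set v i l p
count-set (true ∷ v)  (suc i) (suc l) p = trans (cong suc (count-set v i l p)) (sym (ℕ.+-suc _ _))

below : ∀ {k} → Word k → ℕ → ℕ
below []      l = 0
below (x ∷ c) l = ind< (rank x) l + below c l

count-indicator : ∀ {k} {c : Word k} l → Ascending c → count (indicator c) l ≡ below c l
count-indicator {k} l [] = count-∅ (double k) l
  where
  count-∅ : ∀ n l → count {n} ∅ l ≡ 0
  count-∅ zero    l       = refl
  count-∅ (suc n) zero    = refl
  count-∅ (suc n) (suc l) = count-∅ n l
count-indicator {c = x ∷ c} l (x<c ∷ asc) =
  trans (count-set (indicator c) (pos x) l (indicator-below x<c))
        (cong₂ _+_ (cong (λ m → ind< m l) (toℕ-pos x)) (count-indicator l asc))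

data Dominates {k} : Word k → Word k → Set where
  []  : ∀ {c} → Dominates c []
  _∷_ : ∀ {x y c e} → x ≤ y → Dominates c e → Dominates (x ∷ c) (y ∷ e)

below-dominated : ∀ {k} {c e : Word k} l → Dominates c e → below e l ℕ.≤ below c l
below-dominated l []          = z≤n
below-dominated l (x≤y ∷ dom) = ℕ.+-mono-≤ (ind<-antitone l x≤y) (below-dominated l dom)

raise-dominated : ∀ {k} {c e : Word k} → Ascending c → Ascending e → Dominates c e →
  raise (indicator c) (indicator e) ≡ (indicator c , indicator e)
raise-dominated asc asc′ dom = raiseFrom-fixed 0 _ _ λ l →
  subst₂ ℕ._≤_ (sym (count-indicator l asc′)) (sym (count-indicator l asc)) (below-dominated l dom)

-- The entries of a column of a King tableau that starts in row n (counted from 0).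
data KingFrom {k} : ℕ → Word k → Set where
  []  : ∀ {n} → KingFrom n []
  _∷_ : ∀ {n x c} → 2 * n ℕ.≤ rank x → KingFrom (suc n) c → KingFrom n (x ∷ c)

double≡2* : ∀ n → double n ≡ 2 * n
double≡2* zero    = refl
double≡2* (suc n) = trans (cong (λ n → suc (suc n)) (double≡2* n)) (sym (ℕ.*-suc 2 n))

-- An entry in row m has index at least m, so only the rows from n to j - 1 can hold an index below
-- j.
below-king : ∀ {k n} {c : Word k} j → KingFrom n c → below c (double j) ℕ.≤ j ∸ n
below-king j [] = z≤n
below-king {n = n} {x ∷ c} j (n≤x ∷ king) with ℕ.<-≤-connex n j
... | inj₁ n<j = ℕ.≤-trans (ℕ.+-mono-≤ (ind<-antitone {0} {rank x} (double j) z≤n) (below-king j king)) (one n<j)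
  where
  one : ∀ {n j} → n ℕ.< j → ind< 0 (double j) + (j ∸ suc n) ℕ.≤ j ∸ n
  one {zero} {suc j} _ = ℕ.≤-refl
  one {suc n} {suc (suc j)} (s≤s n<j) = one n<j
... | inj₂ j≤n =
  subst₂ (λ a b → a + b ℕ.≤ j ∸ n)
    (sym (ind<-no (ℕ.≤-trans (ℕ.≤-trans (ℕ.≤-reflexive (double≡2* j)) (ℕ.*-monoʳ-≤ 2 j≤n)) n≤x)))
    (sym (ℕ.n≤0⇒n≡0 (ℕ.≤-trans (below-king j king) (ℕ.≤-reflexive (ℕ.m≤n⇒m∸n≡0 (ℕ.m≤n⇒m≤1+n j≤n))))))
    z≤n

insert-commute : ∀ {n} (v : Vec Bool n) i j → v [ i ]≔ true [ j ]≔ true ≡ v [ j ]≔ true [ i ]≔ true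
insert-commute v i j with i Fin.≟ j
... | yes refl = refl
... | no  i≢j  = []≔-commutes v i j i≢j

indicator-insert : ∀ {k} (A C : Word k) x → indicator (A ++ x ∷ C) ≡ indicator (A ++ C) [ pos x ]≔ true
indicator-insert []      C x = refl
indicator-insert (y ∷ A) C x =
  trans (cong (_[ pos y ]≔ true) (indicator-insert A C x)) (insert-commute (indicator (A ++ C)) (pos x) (pos y))

remove-inserted : ∀ {n} (v : Vec Bool n) i → lookup v i ≡ false → v [ i ]≔ true [ i ]≔ false ≡ v
remove-inserted v i p =
  trans ([]≔-idempotent v i) (trans (cong (v [ i ]≔_) (sym p)) ([]≔-lookup v i))

below-++ : ∀ {k} (A C : Word k) l → below (A ++ C) l ≡ below A l + below C l
below-++ []      C l = refl
below-++ (x ∷ A) C l = trans (cong (ind< (rank x) l +_) (below-++ A C l)) (sym (ℕ.+-assoc (ind< (rank x) l) _ _))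

below-all : ∀ {k} {c : Word k} {l} → All (λ y → rank y ℕ.< l) c → below c l ≡ length c
below-all []          = refl
below-all (y<l ∷ c<l) = cong₂ _+_ (ind<-yes y<l) (below-all c<l)

below-none : ∀ {k} {c : Word k} {l} → All (λ y → l ℕ.≤ rank y) c → below c l ≡ 0
below-none []          = refl
below-none (l≤y ∷ l≤c) = cong₂ _+_ (ind<-no l≤y) (below-none l≤c)

AllPairs-++⁻ : ∀ {k} (A : Word k) {C} → Ascending (A ++ C) → All (λ x → All (x <_) C) A × Ascending C
AllPairs-++⁻ []      asc         = [] , asc
AllPairs-++⁻ (x ∷ A) (x< ∷ asc) = let (A<C , ascC) = AllPairs-++⁻ A asc in All.++⁻ʳ A x< ∷ A<C , ascC

-- The entries of A are i in number and all smaller than `plain i`, so the bound for King columns is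
-- attained just before index i. No capacity is left for the pair that ī completes.
cancel-indicator : ∀ {k} (A C : Word k) (i : Fin k) → length A ≡ toℕ i →
  Ascending (A ++ plain i ∷ C) → All (bar i <_) C → KingFrom 0 (A ++ plain i ∷ C) →
  cancelCol (indicator (A ++ plain i ∷ bar i ∷ C)) ≡ indicator (A ++ C)
cancel-indicator {k} A C i len asc b<C king = begin
  cancelCol (indicator (A ++ p ∷ b ∷ C))            ≡⟨ cong cancelCol inserted ⟩
  cancelCol (indicator (A ++ p ∷ C) [ pos b ]≔ true) ≡⟨ cancelFrom-pair 0 i (indicator (A ++ p ∷ C)) bounds full p∈ b∉ ⟩
  indicator (A ++ p ∷ C) [ pos p ]≔ false           ≡⟨ cong (_[ pos p ]≔ false) (indicator-insert A C p) ⟩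
  indicator (A ++ C) [ pos p ]≔ true [ pos p ]≔ false ≡⟨ remove-inserted (indicator (A ++ C)) (pos p) p∉ ⟩
  indicator (A ++ C)                                 ∎
  where
  open ≡-Reasoning
  p b : Letter k
  p = plain i
  b = bar i
  p<b : p < b
  p<b = ℕ.≤-reflexive (ℕ.+-comm 1 (rank p))
  A<C = proj₁ (AllPairs-++⁻ A asc)
  A<p : All (_< p) A
  A<p = All.map (λ { (x<p ∷ _) → x<p }) A<C
  p<C : All (p <_) C
  p<C with p<C ∷ _ ← proj₂ (AllPairs-++⁻ A asc) = p<C
  avoid> : ∀ {x A} → All (_< x) A → All (λ y → pos x ≢ pos y) A
  avoid> {x} = All.map λ {y} y<x → <⇒pos≢ {x = y} {x} y<x ∘ sym
  avoid< : ∀ {x A} → All (x <_) A → All (λ y → pos x ≢ pos y) A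
  avoid< {x} = All.map λ {y} → <⇒pos≢ {x = x} {y}
  inserted : indicator (A ++ p ∷ b ∷ C) ≡ indicator (A ++ p ∷ C) [ pos b ]≔ true
  inserted = begin
    indicator (A ++ p ∷ b ∷ C)                       ≡⟨ indicator-insert A (b ∷ C) p ⟩
    indicator (A ++ b ∷ C) [ pos p ]≔ true           ≡⟨ cong (_[ pos p ]≔ true) (indicator-insert A C b) ⟩
    indicator (A ++ C) [ pos b ]≔ true [ pos p ]≔ true ≡⟨ insert-commute (indicator (A ++ C)) (pos b) (pos p) ⟩
    indicator (A ++ C) [ pos p ]≔ true [ pos b ]≔ true ≡⟨ cong (_[ pos b ]≔ true) (indicator-insert A C p) ⟨
    indicator (A ++ p ∷ C) [ pos b ]≔ true           ∎
  p∉ : lookup (indicator (A ++ C)) (pos p) ≡ false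
  p∉ = indicator-avoids (All.++⁺ (avoid> {p} A<p) (avoid< {p} p<C))
  p∈ : lookup (indicator (A ++ p ∷ C)) (pos p) ≡ true
  p∈ = trans (cong (λ v → lookup v (pos p)) (indicator-insert A C p)) (lookup∘update (pos p) (indicator (A ++ C)) true)
  b∉ : lookup (indicator (A ++ p ∷ C)) (pos b) ≡ false
  b∉ = indicator-avoids (All.++⁺ (avoid> {b} (All.map (λ {y} y<p → ℕ.<-trans y<p p<b) A<p))
                                  ((<⇒pos≢ {x = p} {b} p<b ∘ sym) ∷ avoid< {b} b<C))
  bounds : ∀ j → count (indicator (A ++ p ∷ C)) (double j) ℕ.≤ 0 + j
  bounds j = ℕ.≤-trans (ℕ.≤-reflexive (count-indicator (double j) asc)) (below-king j king)
  full : count (indicator (A ++ p ∷ C)) (double (toℕ i)) ≡ 0 + toℕ i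
  full = begin
    count (indicator (A ++ p ∷ C)) l  ≡⟨ count-indicator l asc ⟩
    below (A ++ p ∷ C) l              ≡⟨ below-++ A (p ∷ C) l ⟩
    below A l + below (p ∷ C) l       ≡⟨ cong₂ _+_ (below-all (All.map (λ {y} y<p → ℕ.<-≤-trans y<p (ℕ.≤-reflexive (sym l≡))) A<p))
                                                    (below-none {c = p ∷ C} (ℕ.≤-reflexive l≡ ∷ All.map (λ {y} p<y → ℕ.≤-trans (ℕ.≤-reflexive l≡) (ℕ.<⇒≤ p<y)) p<C)) ⟩
    length A + 0                      ≡⟨ ℕ.+-identityʳ _ ⟩
    length A                          ≡⟨ len ⟩
    toℕ i                             ∎
    where
    l = double (toℕ i)
    l≡ : l ≡ rank p
    l≡ = double≡2* (toℕ i)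

-- A King tableau is determined by its sweep

rank-injective : ∀ {k} {x y : Letter k} → rank x ≡ rank y → x ≡ y
rank-injective {x = x} {y} eq =
  pos-injective (Fin.toℕ-injective (trans (toℕ-pos x) (trans eq (sym (toℕ-pos y)))))

indicator-injective : ∀ {k} {c e : Word k} → Ascending c → Ascending e → indicator c ≡ indicator e → c ≡ e
indicator-injective [] [] _ = refl
indicator-injective {e = y ∷ e} [] (_ ∷ _) eq with () ←
  trans (sym (lookup-replicate (pos y) false)) (trans (cong (λ v → lookup v (pos y)) eq) (lookup∘update (pos y) (indicator e) true))
indicator-injective {c = x ∷ c} (_ ∷ _) [] eq with () ←
  trans (sym (lookup-replicate (pos x) false)) (trans (cong (λ v → lookup v (pos x)) (sym eq)) (lookup∘update (pos x) (indicator c) true))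
indicator-injective {c = x ∷ c} {y ∷ e} (x<c ∷ asc) (y<e ∷ asc′) eq = helper (ℕ.<-cmp (rank x) (rank y))
  where
  absurd : ∀ {k} {x y : Letter k} {c e} → x < y → All (y <_) e → indicator (x ∷ c) ≢ indicator (y ∷ e)
  absurd {x = x} {y} {c} x<y y<e eq with () ←
    trans (sym (lookup∘update (pos x) (indicator c) true))
          (trans (cong (λ v → lookup v (pos x)) eq) (indicator-below {x = x} (x<y ∷ All.map (ℕ.<-trans x<y) y<e)))
  helper : _ → x ∷ c ≡ y ∷ e
  helper (tri< x<y _ _) = contradiction eq (absurd {x = x} {y} {c} x<y y<e)
  helper (tri> _ _ y<x) = contradiction (sym eq) (absurd {x = y} {x} {e} y<x x<c)
  helper (tri≈ _ x≡y _) with refl ← rank-injective {x = x} {y} x≡y =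
    cong (x ∷_) (indicator-injective asc asc′ (begin
      indicator c                              ≡⟨ remove-inserted (indicator c) (pos x) (indicator-below x<c) ⟨
      indicator (x ∷ c) [ pos x ]≔ false       ≡⟨ cong (_[ pos x ]≔ false) eq ⟩
      indicator (x ∷ e) [ pos x ]≔ false       ≡⟨ remove-inserted (indicator e) (pos x) (indicator-below y<e) ⟩
      indicator e                              ∎))
    where open ≡-Reasoning

-- The columns of a King tableau from right to left.
data KingColumns {k} : List (Word k) → Set where
  []    : KingColumns []
  first : ∀ {c} → c ≢ [] → Ascending c → KingFrom 0 c → KingColumns (c ∷ [])
  next  : ∀ {c e cs} → e ≢ [] → Ascending e → Dominates c e → KingColumns (c ∷ cs) → KingColumns (e ∷ c ∷ cs)

ascending : ∀ {k} {c : Word k} {cs} → KingColumns (c ∷ cs) → Ascending c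
ascending (first _ asc _) = asc
ascending (next _ asc _ _) = asc

sweep-king : ∀ {k} {c : Word k} {cs} → KingColumns (c ∷ cs) →
  sweep (fromList (map indicator (c ∷ cs))) ≡ fromList (map indicator (c ∷ cs))
sweep-king (first _ asc king) = cong (_∷ []) (cancelFrom-fixed 0 _ λ j →
  ℕ.≤-trans (ℕ.≤-reflexive (count-indicator (double j) asc)) (below-king j king))
sweep-king {c = e} {c ∷ cs} (next _ asc dom cols) = begin
  adjoin (under sweep (adjoin v))  ≡⟨ cong (adjoin ∘ under sweep) fixed ⟩
  adjoin (under sweep v)           ≡⟨ cong (λ w → adjoin (indicator e ∷ w)) (sweep-king cols) ⟩
  adjoin v                         ≡⟨ fixed ⟩
  v                                ∎
  where
  open ≡-Reasoning
  v = fromList (map indicator (e ∷ c ∷ cs))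
  fixed : adjoin v ≡ v
  fixed = cong (λ (c , e) → e ∷ c ∷ fromList (map indicator cs)) (raise-dominated (ascending cols) asc dom)

sweepAll-king : ∀ {k} {cs : List (Word k)} → KingColumns cs →
  sweepAll (map indicator cs) ≡ fromList (map indicator cs)
sweepAll-king []                  = refl
sweepAll-king cols@(first _ _ _)  = sweep-king cols
sweepAll-king {cs = e ∷ _} cols@(next _ _ _ rest) = trans (cong (λ v → sweep (indicator e ∷ v)) (sweepAll-king rest)) (sweep-king cols)

core-king : ∀ {k} {cs : List (Word k)} → KingColumns cs → core (map indicator cs) ≡ (_ , fromList (map indicator cs))
core-king {cs = cs} cols = trans (cong trim (sweepAll-king cols)) (trim-king cs (nonempty cols))
  where
  nonempty : ∀ {k} {cs : List (Word k)} → KingColumns cs → All (_≢ []) cs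
  nonempty []                 = []
  nonempty (first ne _ _)     = ne ∷ []
  nonempty (next ne _ _ cols) = ne ∷ nonempty cols
  trim-king : ∀ {k} (cs : List (Word k)) → All (_≢ []) cs →
    trim (fromList (map indicator cs)) ≡ (_ , fromList (map indicator cs))
  trim-king [] _ = refl
  trim-king ([] ∷ cs) (ne ∷ _) = contradiction refl ne
  trim-king ((x ∷ c) ∷ cs) _ with ≡-dec Bool._≟_ (indicator (x ∷ c)) ∅
  ... | no  _  = refl
  ... | yes eq with () ← trans (sym (lookup∘update (pos x) (indicator c) true))
                               (trans (cong (λ v → lookup v (pos x)) eq) (lookup-replicate (pos x) false))

king-columns-unique : ∀ {k} {cs ds : List (Word k)} → KingColumns cs → KingColumns ds →
  map indicator cs ≈ map indicator ds → cs ≡ ds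
king-columns-unique {k} {cs} {ds} cols cols′ (same eq) =
  injective (ascendings cols) (ascendings cols′) (begin
    map indicator cs                                ≡⟨ toList∘fromList _ ⟨
    toList (fromList (map indicator cs))            ≡⟨ cong (λ (_ , v) → toList v) (trans (sym (core-king cols)) (trans eq (core-king cols′))) ⟩
    toList (fromList (map indicator ds))            ≡⟨ toList∘fromList _ ⟩
    map indicator ds                                ∎)
  where
  open ≡-Reasoning
  ascendings : ∀ {cs : List (Word k)} → KingColumns cs → All Ascending cs
  ascendings []                  = []
  ascendings (first _ asc _)     = asc ∷ []
  ascendings (next _ asc _ cols) = asc ∷ ascendings cols
  injective : ∀ {cs ds : List (Word k)} → All Ascending cs → All Ascending ds → map indicator cs ≡ map indicator ds → cs ≡ ds
  injective []           []             _  = refl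
  injective (asc ∷ ascs) (asc′ ∷ ascs′) eq = cong₂ _∷_
    (indicator-injective asc asc′ (proj₁ (∷-injective eq))) (injective ascs ascs′ (proj₂ (∷-injective eq)))

columnsWord : ∀ {k} → List (Word k) → Word k
columnsWord []       = []
columnsWord (c ∷ cs) = columnsWord cs ++ reverse c

code-column : ∀ {k} {c : Word k} w → Ascending c → code (w ++ reverse c) ≈ indicator c ∷ code w
code-column {c = c} w asc = subst (_≈ indicator c ∷ code w)
  (sym (trans (code-++ w (reverse c)) (cong (λ c → map (single ∘ pos) c ++ code w) (reverse-involutive c))))
  (≈-column (code w) asc)

code-columns : ∀ {k} {cs : List (Word k)} → KingColumns cs → code (columnsWord cs) ≈ map indicator cs
code-columns []                                 = ≈-refl
code-columns (first _ asc _)                    = code-column [] asc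
code-columns {cs = e ∷ c ∷ cs} (next _ asc _ cols) =
  ≈-trans (code-column (columnsWord (c ∷ cs)) asc) (≈-∷ (indicator e) (code-columns cols))

-- Knuth equivalence of row words

Sorted : ∀ {k} → Word k → Set
Sorted = Linked _≤_

module _ {k : ℕ.ℕ} where

  ≡A-sym : ∀ {w w′ : Word k} → w ≡A w′ → w′ ≡A w
  ≡A-sym = Eq.symmetric KnuthMove

  ≡A-∷ : ∀ (x : Letter k) {w w′} → w ≡A w′ → x ∷ w ≡A x ∷ w′
  ≡A-∷ x = Eq.gmap (x ∷_) move
    where
    move : ∀ {w w′} → KnuthMove w w′ → KnuthMove (x ∷ w) (x ∷ w′)
    move (yxz→yzx u v p q) = yxz→yzx (x ∷ u) v p q
    move (xzy→zxy u v p q) = xzy→zxy (x ∷ u) v p q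

  ≡A-++ˡ : ∀ (u : Word k) {w w′} → w ≡A w′ → u ++ w ≡A u ++ w′
  ≡A-++ˡ []      eq = eq
  ≡A-++ˡ (x ∷ u) eq = ≡A-∷ x (≡A-++ˡ u eq)

  ≡A-ʳ++ : ∀ (u : Word k) {w w′} → w ≡A w′ → u ʳ++ w ≡A u ʳ++ w′
  ≡A-ʳ++ []      eq = eq
  ≡A-ʳ++ (x ∷ u) eq = ≡A-ʳ++ u (≡A-∷ x eq)

  ≡A-++ʳ : ∀ {w w′} (s : Word k) → w ≡A w′ → w ++ s ≡A w′ ++ s
  ≡A-++ʳ s = Eq.gmap (_++ s) move
    where
    move : ∀ {w w′} → KnuthMove w w′ → KnuthMove (w ++ s) (w′ ++ s)
    move (yxz→yzx u v p q) = subst₂ KnuthMove (sym (++-assoc u _ s)) (sym (++-assoc u _ s)) (yxz→yzx u (v ++ s) p q)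
    move (xzy→zxy u v p q) = subst₂ KnuthMove (sym (++-assoc u _ s)) (sym (++-assoc u _ s)) (xzy→zxy u (v ++ s) p q)

  ≡A-reflexive : ∀ {w w′ : Word k} → w ≡ w′ → w ≡A w′
  ≡A-reflexive refl = ε

  yxz≡yzx : ∀ {x y z : Letter k} v → x < y → y ≤ z → y ∷ x ∷ z ∷ v ≡A y ∷ z ∷ x ∷ v
  yxz≡yzx v x<y y≤z = fwd (yxz→yzx [] v x<y y≤z) ◅ ε

  xzy≡zxy : ∀ {x y z : Letter k} v → x ≤ y → y < z → x ∷ z ∷ y ∷ v ≡A z ∷ x ∷ y ∷ v
  xzy≡zxy v x≤y y<z = fwd (xzy→zxy [] v x≤y y<z) ◅ ε

  -- The row word, bottom row first, followed by v. Keeping v as an argument lets statements about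
  -- the lower rows be applied with the upper rows inside v.
  reading : Tableau k → Word k → Word k
  reading []      v = v
  reading (r ∷ t) v = reading t (r ++ v)

  ≡A-reading : ∀ t {w w′ : Word k} → w ≡A w′ → reading t w ≡A reading t w′
  ≡A-reading []      eq = eq
  ≡A-reading (r ∷ t) eq = ≡A-reading t (≡A-++ˡ r eq)

  -- Each letter r of R is passed with its left neighbour a as witness: x < a ≤ r.
  smaller-left : ∀ {a x : Letter k} R v → x < a → Sorted (a ∷ R) → a ∷ R ++ x ∷ v ≡A a ∷ x ∷ R ++ v
  smaller-left []      v x<a _            = ε
  smaller-left (r ∷ R) v x<a (a≤r ∷ rR) =
    ≡A-∷ _ (smaller-left R v (ℕ.<-≤-trans x<a a≤r) rR) ◅◅ ≡A-sym (yxz≡yzx (R ++ v) x<a a≤r)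

  -- First x travels left through s until it stands next to y; then y travels left through l, where
  -- the letter behind it, x or an entry of l, is the witness.
  row-bump : ∀ {x y : Letter k} l s v → Sorted (l ++ y ∷ s) → All (_≤ x) l → x < y →
    l ++ y ∷ s ++ x ∷ v ≡A y ∷ l ++ x ∷ s ++ v
  row-bump {x} {y} l s v sorted l≤x x<y = ≡A-++ˡ l (smaller-left s v x<y (suffix l sorted)) ◅◅ move l sorted l≤x
    where
    suffix : ∀ l → Sorted (l ++ y ∷ s) → Sorted (y ∷ s)
    suffix []      sorted = sorted
    suffix (_ ∷ l) sorted = suffix l (Linked.tail sorted)
    swap : ∀ a l → a ≤ x → Sorted (a ∷ l ++ y ∷ s) → All (_≤ x) l → a ∷ y ∷ l ++ x ∷ s ++ v ≡A y ∷ a ∷ l ++ x ∷ s ++ v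
    swap a []      a≤x _          _         = xzy≡zxy (s ++ v) a≤x x<y
    swap a (b ∷ l) a≤x (a≤b ∷ _) (b≤x ∷ _) = xzy≡zxy (l ++ x ∷ s ++ v) a≤b (ℕ.≤-<-trans b≤x x<y)
    move : ∀ l → Sorted (l ++ y ∷ s) → All (_≤ x) l → l ++ y ∷ x ∷ s ++ v ≡A y ∷ l ++ x ∷ s ++ v
    move []      _      _             = ε
    move (a ∷ l) sorted (a≤x ∷ l≤x) =
      ≡A-∷ a (move l (Linked.tail sorted) l≤x) ◅◅ swap a l a≤x sorted l≤x

  data Above : Word k → Word k → Set where
    []  : ∀ {r} → Above r []
    _∷_ : ∀ {x y r d} → x < y → Above r d → Above (x ∷ r) (y ∷ d)

  above-shift : ∀ {x r X R} → x < r → Above X R → Sorted (r ∷ R) → Above (x ∷ X) R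
  above-shift x<r []             _            = []
  above-shift x<r (x′<r′ ∷ ab) (r≤r′ ∷ rs) = ℕ.<-≤-trans x<r r≤r′ ∷ above-shift x′<r′ ab rs

  -- After x is brought next to r, the letter b can pass r because b ≤ x < r. Then x returns through
  -- R by one recursive call, and b crosses R by a second one in which x belongs to the upper row.
  slide-right : ∀ {b} R X v → Sorted (b ∷ X) → Sorted R → Above X R → b ∷ R ++ X ++ v ≡A R ++ b ∷ X ++ v
  slide-right []      X       v _            _  _            = ε
  slide-right {b} (r ∷ R) (x ∷ X) v (b≤x ∷ xs) rs (x<r ∷ ab) =
    ≡A-∷ b (smaller-left R (X ++ v) x<r rs)
    ◅◅ xzy≡zxy (R ++ X ++ v) b≤x x<r
    ◅◅ ≡A-∷ r (≡A-∷ b (slide-right R X v xs (Linked.tail rs) ab)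
               ◅◅ slide-right R (x ∷ X) v (b≤x ∷ xs) (Linked.tail rs) (above-shift x<r ab rs))

  delete : ∀ {b} (l : Word k) {R} → Sorted (l ++ b ∷ R) → Sorted (l ++ R)
  delete []           rs                = Linked.tail rs
  delete (a ∷ [])     {[]}    _         = [-]
  delete (a ∷ [])     {r ∷ R} (p ∷ q ∷ rs) = ℕ.≤-trans p q ∷ rs
  delete (a ∷ a′ ∷ l) (p ∷ rs)         = p ∷ delete (a′ ∷ l) rs

  -- Jeu de taquin on two rows: b moves up from the lower row l′ b R into the upper row l □ X.
  slide-up : ∀ {b} l′ l R X v → Pointwise _<_ l l′ → Sorted (l′ ++ b ∷ R) → Sorted (b ∷ X) → Above X R →
    l′ ++ b ∷ R ++ l ++ X ++ v ≡A l′ ++ R ++ l ++ b ∷ X ++ v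
  slide-up [] [] R X v [] rs xs ab = slide-right R X v xs (Linked.tail rs) ab
  slide-up {b} (a ∷ l′) (c ∷ l) R X v (c<a ∷ l<l′) rs xs ab =
    ≡A-reflexive (cong (a ∷_) (sym (++-assoc l′ (b ∷ R) _)))
    ◅◅ smaller-left (l′ ++ b ∷ R) (l ++ X ++ v) c<a rs
    ◅◅ ≡A-reflexive (cong (λ w → a ∷ c ∷ w) (++-assoc l′ (b ∷ R) _))
    ◅◅ ≡A-∷ a (≡A-∷ c (slide-up l′ l R X v l<l′ (Linked.tail rs) xs ab))
    ◅◅ ≡A-reflexive (cong (λ w → a ∷ c ∷ w) (sym (++-assoc l′ R _)))
    ◅◅ ≡A-sym (smaller-left (l′ ++ R) (l ++ b ∷ X ++ v) c<a (delete (a ∷ l′) rs))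
    ◅◅ ≡A-reflexive (cong (a ∷_) (++-assoc l′ R _))

  -- The rows of a tableau, detached from the first column c.
  data Pairs : Word k → Tableau k → Set where
    []  : ∀ {c} → Pairs c []
    _∷_ : ∀ {x y c t} → Sorted (x ∷ y) → Pairs c t → Pairs (x ∷ c) (y ∷ t)

  sorted-lower : ∀ {a b : Letter k} {y} → a < b → Sorted (b ∷ y) → Sorted (a ∷ y)
  sorted-lower a<b [-]         = [-]
  sorted-lower a<b (b≤y ∷ ys) = ℕ.≤-trans (ℕ.<⇒≤ a<b) b≤y ∷ ys

  pairs-shift : ∀ {x c t} → Linked _<_ (x ∷ c) → Pairs c t → Pairs (x ∷ c) t
  pairs-shift _           []        = []
  pairs-shift (x<c ∷ asc) (cy ∷ ps) = sorted-lower x<c cy ∷ pairs-shift asc ps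

  -- The head a of a row is sent back in front of its tail y. There x < a ≤ y lets x pass y, after
  -- which a rejoins the column and x crosses the remaining tails.
  column-through : ∀ {x} c t v → Linked _<_ (x ∷ c) → Pairs c t → c ʳ++ reading t (x ∷ v) ≡A c ʳ++ x ∷ reading t v
  column-through c       []      v _            _           = ε
  column-through {x} (a ∷ c) (y ∷ t) v (x<a ∷ asc) (ay ∷ ps) =
    ≡A-sym (column-through c t (y ++ x ∷ v) asc ps)
    ◅◅ ≡A-ʳ++ c (≡A-reading t (smaller-left y v x<a ay))
    ◅◅ column-through c t (x ∷ y ++ v) asc ps
    ◅◅ column-through (a ∷ c) t (y ++ v) (x<a ∷ asc) (pairs-shift asc ps)

-- Jeu de taquin on King tableaux

module _ {k : ℕ} where

  top : Tableau k → Row k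
  top []      = []
  top (r ∷ _) = r

  -- King tableaux whose first row is row n of the whole (counted from 0).
  data King : ℕ → Tableau k → Set where
    []  : ∀ {n} → King n []
    row : ∀ {n r t} → r ≢ [] → Sorted r → All (λ x → 2 * n ℕ.≤ rank x) r → Above r (top t) →
          King (suc n) t → King n (r ∷ t)

  ++≢[] : ∀ (l : Word k) {x r} → l ++ x ∷ r ≢ []
  ++≢[] []      ()
  ++≢[] (_ ∷ _) ()

  above-++ : ∀ {l d : Word k} r → Above l d → Above (l ++ r) d
  above-++ r []          = []
  above-++ r (x<y ∷ ab) = x<y ∷ above-++ r ab

  above-pointwise : ∀ {l l′ r d : Word k} → Pointwise _<_ l l′ → Above r d → Above (l ++ r) (l′ ++ d)
  above-pointwise []            ab = ab
  above-pointwise (x<y ∷ l<l′) ab = x<y ∷ above-pointwise l<l′ ab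

  data SplitAbove (l : Word k) (h : Letter k) (r : Word k) : Row k → Set where
    short : ∀ {d} → Above l d → SplitAbove l h r d
    long  : ∀ {l′ b r′} → Pointwise _<_ l l′ → h < b → Above r r′ → SplitAbove l h r (l′ ++ b ∷ r′)

  split-above : ∀ l {h r d} → Above (l ++ h ∷ r) d → SplitAbove l h r d
  split-above []      []           = short []
  split-above []      (h<b ∷ ab)  = long [] h<b ab
  split-above (_ ∷ l) []           = short []
  split-above (_ ∷ l) (x<y ∷ ab) with split-above l ab
  ... | short ab′         = short (x<y ∷ ab′)
  ... | long l<l′ h<b ab′ = long (x<y ∷ l<l′) h<b ab′

  splitAt-above : ∀ {l d : Word k} → Above l d → splitAt (length l) d ≡ (d , [])
  splitAt-above {[]}    []          = refl
  splitAt-above {_ ∷ _} []          = refl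
  splitAt-above         (_ ∷ ab) rewrite splitAt-above ab = refl

  splitAt-pointwise : ∀ {l l′ : Word k} {d} → Pointwise _<_ l l′ → splitAt (length l) (l′ ++ d) ≡ (l′ , d)
  splitAt-pointwise []                              = refl
  splitAt-pointwise {d = d} (_ ∷ l<l′) rewrite splitAt-pointwise {d = d} l<l′ = refl

  pointwise-∷ʳ : ∀ {l l′ : Word k} {x b} → Pointwise _<_ l l′ → x < b → Pointwise _<_ (l ∷ʳ x) (l′ ∷ʳ b)
  pointwise-∷ʳ []            x<b = x<b ∷ []
  pointwise-∷ʳ (p ∷ l<l′) x<b = p ∷ pointwise-∷ʳ l<l′ x<b

  -- In `downs`, m is the stretch of entries that slide left before b comes up from the row below.
  data SlideSpec (l r d : Row k) : RowSlide k → Set where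
    stops : Above (l ++ r) d → SlideSpec l r d (stop (l ++ r))
    downs : ∀ {l′ b r′} m X → r ≡ m ++ X → d ≡ l′ ++ b ∷ r′ → Pointwise _<_ (l ++ m) l′ →
            Sorted (b ∷ X) → Above X r′ → SlideSpec l r d (down (l ++ m ++ b ∷ X) l′ r′)

  slide-spec-∷ʳ : ∀ l {x r d s} → SlideSpec (l ∷ʳ x) r d s → SlideSpec l (x ∷ r) d s
  slide-spec-∷ʳ l {x} {r} {d} (stops ab) =
    subst (λ w → SlideSpec l (x ∷ r) d (stop w)) (sym (++-assoc l _ r)) (stops (subst (λ w → Above w d) (++-assoc l _ r) ab))
  slide-spec-∷ʳ l {x} {d = d} (downs {l′} {b} {r′} m X refl eq l<l′ bX ab) =
    subst (λ w → SlideSpec l (x ∷ m ++ X) d (down w l′ r′)) (sym (++-assoc l _ _))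
      (downs (x ∷ m) X refl eq (subst (λ w → Pointwise _<_ w l′) (++-assoc l _ m) l<l′) bX ab)

  slideRow-short : ∀ l r {d} → Above l d → SlideSpec l r d (slideRow l r d)
  slideRow-short l []      {d} ab rewrite splitAt-above ab =
    subst (λ w → SlideSpec l [] d (stop w)) (++-identityʳ l) (stops (above-++ [] ab))
  slideRow-short l (x ∷ r) ab rewrite splitAt-above ab =
    slide-spec-∷ʳ l (slideRow-short (l ∷ʳ x) r (above-++ _ ab))

  slideRow-long : ∀ l r {l′ b r′} → Sorted r → Pointwise _<_ l l′ → Above r r′ →
    SlideSpec l r (l′ ++ b ∷ r′) (slideRow l r (l′ ++ b ∷ r′))
  slideRow-long l []      {l′} {b} {[]} _ l<l′ ab rewrite splitAt-pointwise {d = b ∷ []} l<l′ =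
    downs [] [] refl refl (subst (λ w → Pointwise _<_ w l′) (sym (++-identityʳ l)) l<l′) [-] []
  slideRow-long l (x ∷ r) {l′} {b} {r′} sorted l<l′ ab rewrite splitAt-pointwise {d = b ∷ r′} l<l′ with x <? b
  ... | no  x≮b = downs [] (x ∷ r) refl refl (subst (λ w → Pointwise _<_ w l′) (sym (++-identityʳ l)) l<l′)
                        (ℕ.≮⇒≥ x≮b ∷ sorted) ab
  ... | yes x<b with ab
  ...   | [] = slide-spec-∷ʳ l (slideRow-short (l ∷ʳ x) r (above-∷ʳ l<l′))
    where
    above-∷ʳ : ∀ {l l′} → Pointwise _<_ l l′ → Above (l ∷ʳ x) (l′ ∷ʳ b)
    above-∷ʳ l<l′ = above-pointwise l<l′ (x<b ∷ [])
  ...   | _∷_ {y = b′} {d = r″} _ ab′ = slide-spec-∷ʳ l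
    (subst (λ d → SlideSpec (l ∷ʳ x) r d (slideRow (l ∷ʳ x) r d)) (++-assoc l′ (b ∷ []) (b′ ∷ r″))
      (slideRow-long (l ∷ʳ x) r (Linked.tail sorted) (pointwise-∷ʳ l<l′ x<b) ab′))

  slideRow-spec : ∀ l {h} r {d} → Sorted r → Above (l ++ h ∷ r) d → SlideSpec l r d (slideRow l r d)
  slideRow-spec l r sorted ab with split-above l ab
  ... | short ab′       = slideRow-short l r ab′
  ... | long l<l′ _ ab′ = slideRow-long l r sorted l<l′ ab′

  sorted-suffix : ∀ (l : Word k) {r} → Sorted (l ++ r) → Sorted r
  sorted-suffix []      sorted = sorted
  sorted-suffix (_ ∷ l) sorted = sorted-suffix l (Linked.tail sorted)

  sorted-insert : ∀ {L l′ : Word k} {b r′ X} → Pointwise _<_ L l′ → Sorted (l′ ++ b ∷ r′) → Sorted (L ++ X) →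
    Sorted (b ∷ X) → Sorted (L ++ b ∷ X)
  sorted-insert []                    _         _         bX = bX
  sorted-insert (x<y ∷ [])           (y≤b ∷ _) _         bX = ℕ.≤-trans (ℕ.<⇒≤ x<y) y≤b ∷ bX
  sorted-insert (x<y ∷ p ∷ L<l′) (_ ∷ s′)  (q ∷ s) bX = q ∷ sorted-insert (p ∷ L<l′) s′ s bX

  -- The row U₁ u U₂ stays above the row l □ r, which held h in the empty box, whatever fills the box.
  data AboveHole (h : Letter k) : Row k → Row k → Row k → Set where
    hole : ∀ {u U r} → u ≤ h → Above U r → Above (u ∷ U) r → AboveHole h (u ∷ U) [] r
    _∷_  : ∀ {u U x l r} → u < x → AboveHole h U l r → AboveHole h (u ∷ U) (x ∷ l) r

  aboveHole-closed : ∀ {h U l r} → AboveHole h U l r → Above U (l ++ r)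
  aboveHole-closed (hole _ _ ab) = ab
  aboveHole-closed (u<x ∷ ab)   = u<x ∷ aboveHole-closed ab

  aboveHole-filled : ∀ {h U l l′ b r′ X} m → AboveHole h U l (m ++ X) → Pointwise _<_ (l ++ m) l′ →
    Above (l ++ h ∷ m ++ X) (l′ ++ b ∷ r′) → Above U (l ++ m ++ b ∷ X)
  aboveHole-filled m (u<x ∷ ab) (_ ∷ l<l′) (_ ∷ ab′) = u<x ∷ aboveHole-filled m ab l<l′ ab′
  aboveHole-filled m (hole u≤h ab ab₁) m<l′ ab′ = fill m u≤h ab ab₁ m<l′ ab′
    where
    fill : ∀ {h u U l′ b r′ X} m → u ≤ h → Above U (m ++ X) → Above (u ∷ U) (m ++ X) → Pointwise _<_ m l′ →
      Above (h ∷ m ++ X) (l′ ++ b ∷ r′) → Above (u ∷ U) (m ++ b ∷ X)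
    fill []      u≤h ab         _            []         (h<b ∷ _)   = ℕ.≤-<-trans u≤h h<b ∷ ab
    fill (_ ∷ m) _   (u<z ∷ ab) (u′<z ∷ ab₁) (_ ∷ m<l′) (_ ∷ ab′) =
      u′<z ∷ fill m (ℕ.<⇒≤ u<z) ab ab₁ m<l′ ab′

  -- The letter b that moved up now stands above the box it has left; this is why `hole` asks only
  -- for u ≤ h.
  aboveHole : ∀ {L l′ : Word k} {b X r′} → Pointwise _<_ L l′ → Sorted (b ∷ X) → Sorted (b ∷ r′) → Above X r′ →
    AboveHole b (L ++ b ∷ X) l′ r′
  aboveHole []            bX br ab = hole ℕ.≤-refl ab (shift bX br ab)
    where
    shift : ∀ {b X r} → Sorted (b ∷ X) → Sorted (b ∷ r) → Above X r → Above (b ∷ X) r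
    shift _          _               []          = []
    shift (b≤x ∷ xs) (_ ∷ rs) (x<r ∷ ab) = ℕ.≤-<-trans b≤x x<r ∷ above-shift x<r ab rs
  aboveHole (x<y ∷ L<l′) bX br ab = x<y ∷ aboveHole L<l′ bX br ab

  -- `tops` serves the row above, which is completed before the slide in the lower rows ends and
  -- must stay above whatever their top row becomes.
  record Slid (n : ℕ) (l : Row k) (h : Letter k) (r : Row k) (t t′ : Tableau k) : Set where
    field
      king  : King n t′
      words : ∀ v → reading t (l ++ r ++ v) ≡A reading t′ v
      tops  : ∀ {U} → AboveHole h U l r → Above U (top t′)

  king-prepend : ∀ {n r t} → Sorted r → All (λ x → 2 * n ℕ.≤ rank x) r → Above r (top t) → King (suc n) t →
    (r ≡ [] → t ≡ []) → King n (prepend r t)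
  king-prepend {r = []}    _ _ _ _ empty rewrite empty refl = []
  king-prepend {r = _ ∷ _} sorted bound ab king _          = row (λ ()) sorted bound ab king

  top-prepend : ∀ {r : Row k} {t} → (r ≡ [] → t ≡ []) → top (prepend r t) ≡ r
  top-prepend {[]}    empty rewrite empty refl = refl
  top-prepend {_ ∷ _} _                        = refl

  reading-prepend : ∀ (r : Row k) t v → reading (prepend r t) v ≡ reading t (r ++ v)
  reading-prepend []      t v = refl
  reading-prepend (_ ∷ _) t v = refl

  drop-middle : ∀ {P : Letter k → Set} l {h r} → All P (l ++ h ∷ r) → All P (l ++ r)
  drop-middle []      (_ ∷ ps) = ps
  drop-middle (_ ∷ l) (p ∷ ps) = p ∷ drop-middle l ps

  slid : ∀ {n} l h r t → King n ((l ++ h ∷ r) ∷ t) → Slid n l h r t (slide l r t)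
  slid l h r [] (row _ sorted bound _ _) = record
    { king  = king-prepend (delete l sorted) (drop-middle l bound) [] [] (λ _ → refl)
    ; words = λ v → ≡A-reflexive (trans (sym (++-assoc l r v)) (sym (reading-prepend (l ++ r) [] v)))
    ; tops  = λ ab → subst (Above _) (sym (top-prepend {l ++ r} (λ _ → refl))) (aboveHole-closed ab)
    }
  slid {n} l h r (d ∷ t) (row _ sorted bound ab king@(row d≢[] sorted′ bound′ ab′ king′))
    with slideRow l r d | slideRow-spec l r (Linked.tail (sorted-suffix l sorted)) ab
  ... | _ | stops ab₁ = record
    { king  = king-prepend (delete l sorted) (drop-middle l bound) ab₁ king nonempty
    ; words = λ v → ≡A-reflexive (trans (cong (reading (d ∷ t)) (sym (++-assoc l r v))) (sym (reading-prepend (l ++ r) (d ∷ t) v)))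
    ; tops  = λ ab₂ → subst (Above _) (sym (top-prepend {l ++ r} nonempty)) (aboveHole-closed ab₂)
    }
    where
    nonempty : l ++ r ≡ [] → d ∷ t ≡ []
    nonempty eq with [] ← subst (λ w → Above w d) eq ab₁ = contradiction refl d≢[]
  ... | _ | downs {l′} {b} {r′} m X refl refl l<l′ bX ab₁ = record
    { king  = row (λ eq → ++≢[] (l ++ m) (trans (++-assoc l m (b ∷ X)) eq))
                  (subst Sorted (++-assoc l m (b ∷ X))
                    (sorted-insert l<l′ sorted′ (subst Sorted (sym (++-assoc l m X)) (delete l sorted)) bX))
                  (filled-bound l m (drop-middle l bound) (lower-bound (All.++⁻ʳ l′ bound′)))
                  (Slid.tops ih (subst (λ w → AboveHole b w l′ r′) (++-assoc l m (b ∷ X))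
                    (aboveHole l<l′ bX (sorted-suffix l′ sorted′) ab₁)))
                  (Slid.king ih)
    ; words = λ v → ≡A-reading t
        (≡A-reflexive (assoc₁ v) ◅◅ slide-up l′ (l ++ m) r′ X v l<l′ sorted′ bX ab₁ ◅◅ ≡A-reflexive (assoc₂ v))
        ◅◅ Slid.words ih ((l ++ m ++ b ∷ X) ++ v)
    ; tops  = λ ab₂ → aboveHole-filled m ab₂ l<l′ ab
    }
    where
    ih = slid l′ b r′ t king
    filled-bound : ∀ {P : Letter k → Set} l m {b X} → All P (l ++ m ++ X) → P b → All P (l ++ m ++ b ∷ X)
    filled-bound []      []      ps       p = p ∷ ps
    filled-bound []      (_ ∷ m) (q ∷ ps) p = q ∷ filled-bound [] m ps p
    filled-bound (_ ∷ l) m       (q ∷ ps) p = q ∷ filled-bound l m ps p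
    lower-bound : ∀ {b r′} → All (λ x → 2 * suc n ℕ.≤ rank x) (b ∷ r′) → 2 * n ℕ.≤ rank b
    lower-bound (p ∷ _) = ℕ.≤-trans (ℕ.*-monoʳ-≤ 2 (ℕ.n≤1+n n)) p
    assoc₁ : ∀ v → (l′ ++ b ∷ r′) ++ l ++ (m ++ X) ++ v ≡ l′ ++ b ∷ r′ ++ (l ++ m) ++ X ++ v
    assoc₁ v = trans (++-assoc l′ (b ∷ r′) _)
      (cong (λ w → l′ ++ b ∷ r′ ++ w) (trans (cong (l ++_) (++-assoc m X v)) (sym (++-assoc l m (X ++ v)))))
    assoc₂ : ∀ v → l′ ++ r′ ++ (l ++ m) ++ b ∷ X ++ v ≡ l′ ++ r′ ++ (l ++ m ++ b ∷ X) ++ v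
    assoc₂ v = cong (λ w → l′ ++ r′ ++ w)
      (trans (++-assoc l m (b ∷ X ++ v)) (sym (trans (++-assoc l (m ++ b ∷ X) v) (cong (l ++_) (++-assoc m (b ∷ X) v)))))

-- Berele insertion

data Broken {A : Set} (P : Pred A 0ℓ) (xs : List A) : List A × List A → Set where
  nowhere : All (¬_ ∘ P) xs → Broken P xs (xs , [])
  at      : ∀ {l y r} → xs ≡ l ++ y ∷ r → All (¬_ ∘ P) l → P y → Broken P xs (l , y ∷ r)

break-broken : ∀ {A : Set} {P : Pred A 0ℓ} (P? : Decidable P) xs → Broken P xs (break P? xs)
break-broken P? [] = nowhere []
break-broken P? (x ∷ xs) with P? x
... | yes px = at refl [] px
... | no ¬px with break P? xs | break-broken P? xs
...   | _ | nowhere ¬ps       = nowhere (¬px ∷ ¬ps)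
...   | _ | at refl ¬ps py = at refl (¬px ∷ ¬ps) py

module _ {k : ℕ} where

  -- All entries of row n are at least `plain n`, so only copies of i precede the first ī. Once that
  -- ī is replaced, the row begins with i and the hole opens in the first column: hence the left
  -- part `[]` in `cancels`.
  data CancelView (n : ℕ) (x : Letter k) (r : Row k) : Maybe (Row k × Row k) → Set where
    kept    : (∀ i → x ≡ plain i → toℕ i ≡ n → All (_≢ bar i) r) → CancelView n x r nothing
    cancels : ∀ {i l s r″} → x ≡ plain i → toℕ i ≡ n → r ≡ l ++ bar i ∷ s → All (_≤ plain i) l →
              l ++ plain i ∷ s ≡ plain i ∷ r″ → CancelView n x r (just ([] , r″))

  plain<bar : ∀ (i : Fin k) → plain i < bar i
  plain<bar i = ℕ.≤-reflexive (ℕ.+-comm 1 (2 * toℕ i))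

  before-bar : ∀ i l {s} → Sorted (l ++ bar i ∷ s) → All (λ x → 2 * toℕ i ℕ.≤ rank x) l → All (_≢ bar i) l → All (_≡ plain i) l
  before-bar i [] _ _ _ = []
  before-bar i (y ∷ l) sorted (i≤y ∷ bound) (y≢ ∷ l≢) =
    equal y (≤-last l sorted) i≤y y≢ ∷ before-bar i l (Linked.tail sorted) bound l≢
    where
    ≤-last : ∀ {y z} l {s : Word k} → Sorted (y ∷ l ++ z ∷ s) → y ≤ z
    ≤-last []      (p ∷ _)  = p
    ≤-last (_ ∷ l) (p ∷ ps) = ℕ.≤-trans p (≤-last l ps)
    half : ∀ m n → 2 * m ℕ.≤ 2 * n + 1 → m ℕ.≤ n
    half m n p = ℕ.s≤s⁻¹ (ℕ.*-cancelˡ-< 2 m (suc n) (ℕ.≤-trans (s≤s p)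
      (ℕ.≤-reflexive (trans (cong suc (ℕ.+-comm (2 * n) 1)) (sym (ℕ.*-suc 2 n))))))
    equal : ∀ y → y ≤ bar i → 2 * toℕ i ℕ.≤ rank y → y ≢ bar i → y ≡ plain i
    equal (plain j) y≤ i≤y _ = cong plain (Fin.toℕ-injective (ℕ.≤-antisym (half (toℕ j) (toℕ i) y≤) (ℕ.*-cancelˡ-≤ 2 i≤y)))
    equal (bar j) y≤ i≤y y≢ = contradiction
      (cong bar (Fin.toℕ-injective (ℕ.≤-antisym (ℕ.*-cancelˡ-≤ 2 (ℕ.+-cancelʳ-≤ 1 (2 * toℕ j) (2 * toℕ i) y≤)) (half (toℕ i) (toℕ j) i≤y)))) y≢

  cancel-view : ∀ n x r → Sorted r → All (λ y → 2 * n ℕ.≤ rank y) r → CancelView n x r (cancel n x r)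
  cancel-view n (bar i)   r sorted bound = kept λ _ ()
  cancel-view n (plain i) r sorted bound with toℕ i ℕ.≟ n | break (_≟ bar i) r | break-broken (_≟ bar i) r
  ... | no  i≢n  | _ | _ = kept λ { _ refl i≡n → contradiction i≡n i≢n }
  ... | yes refl | _ | nowhere ≢bar = kept λ { _ refl _ → ≢bar }
  ... | yes refl | l , _ ∷ s | at refl l≢ refl
    with break (_≟ plain i) (l ++ plain i ∷ s) | break-broken (_≟ plain i) (l ++ plain i ∷ s) | before-bar i l sorted (All.++⁻ˡ l bound) l≢
  ...   | _ | nowhere ≢plain | _ with ≢ ∷ _ ← All.++⁻ʳ l ≢plain = contradiction refl ≢
  ...   | _ | at {[]} eq _ refl | l≡ = cancels refl refl refl (All.map (λ { refl → ℕ.≤-refl }) l≡) eq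
  ...   | _ | at {_ ∷ _} eq (≢ ∷ _) _ | l≡ = contradiction (starts-plain l l≡ eq) ≢
    where
    starts-plain : ∀ l {z l′ s} → All (_≡ plain i) l → l ++ plain i ∷ s ≡ z ∷ l′ → z ≡ plain i
    starts-plain []      _          refl = refl
    starts-plain (_ ∷ _) (refl ∷ _) refl = refl

  -- This also describes the row in the cancelling case, before the hole is made, so the comparison
  -- with the row above is the same in both cases.
  data RowInsert (x : Letter k) : Row k → Row k → Set where
    end  : RowInsert x [] (x ∷ [])
    bump : ∀ {y r} → x < y → RowInsert x (y ∷ r) (x ∷ r)
    skip : ∀ {y r r′} → y ≤ x → RowInsert x r r′ → RowInsert x (y ∷ r) (y ∷ r′)

  insert-end : ∀ {x l} → All (_≤ x) l → RowInsert x l (l ∷ʳ x)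
  insert-end []          = end
  insert-end (y≤x ∷ l≤x) = skip y≤x (insert-end l≤x)

  insert-bump : ∀ {x y l s} → All (_≤ x) l → x < y → RowInsert x (l ++ y ∷ s) (l ++ x ∷ s)
  insert-bump []          x<y = bump x<y
  insert-bump (y≤x ∷ l≤x) x<y = skip y≤x (insert-bump l≤x x<y)

  insert-sorted : ∀ {x r r′} → RowInsert x r r′ → Sorted r → Sorted r′
  insert-sorted end []                                 = [-]
  insert-sorted (bump x<y) [-]                         = [-]
  insert-sorted (bump x<y) (y≤z ∷ s)                   = ℕ.<⇒≤ (ℕ.<-≤-trans x<y y≤z) ∷ s
  insert-sorted (skip y≤x end) _                       = y≤x ∷ [-]
  insert-sorted (skip y≤x (bump x<z)) (_ ∷ s)          = y≤x ∷ insert-sorted (bump x<z) s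
  insert-sorted (skip _ ins@(skip _ _)) (y≤z ∷ s)      = y≤z ∷ insert-sorted ins s

  insert-all : ∀ {P : Letter k → Set} {x r r′} → RowInsert x r r′ → P x → All P r → All P r′
  insert-all end          p []       = p ∷ []
  insert-all (bump _)     p (_ ∷ qs) = p ∷ qs
  insert-all (skip _ ins) p (q ∷ qs) = q ∷ insert-all ins p qs

  insert-≢[] : ∀ {x r r′} → RowInsert x r r′ → r′ ≢ []
  insert-≢[] end ()

  insert-above : ∀ {x r r′ d} → RowInsert x r r′ → Above r d → Above r′ d
  insert-above _            []          = []
  insert-above (bump x<y)   (y<z ∷ ab) = ℕ.<-trans x<y y<z ∷ ab
  insert-above (skip _ ins) (y<z ∷ ab) = y<z ∷ insert-above ins ab

  -- The entry of d below y, if any, exceeds y, so y enters the next row weakly left of its old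
  -- column. The entry above its new place is at most x, hence smaller than y.
  bump-above : ∀ {x y l s d d′} → All (_≤ x) l → x < y → RowInsert y d d′ → Above (l ++ y ∷ s) d → Above (l ++ x ∷ s) d′
  bump-above []          x<y end          _           = x<y ∷ []
  bump-above (a≤x ∷ _)   x<y end          _           = ℕ.≤-<-trans a≤x x<y ∷ []
  bump-above []          x<y (bump _)     (_ ∷ ab)    = x<y ∷ ab
  bump-above (a≤x ∷ l≤x) x<y (bump _)     (_ ∷ ab)    = ℕ.≤-<-trans a≤x x<y ∷ insert-above (insert-bump l≤x x<y) ab
  bump-above []          x<y (skip b≤y _) (y<b ∷ _)   = contradiction b≤y (ℕ.<⇒≱ y<b)
  bump-above (_ ∷ l≤x)   x<y (skip _ ins) (a<b ∷ ab)  = a<b ∷ bump-above l≤x x<y ins ab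

  -- In `cancelling`, the tableau `ρ ++ (plain i ∷ r″) ∷ t₀` is the one in which i has replaced the
  -- first ī and no box is empty yet. The bumped ī is kept in the word, so up to Knuth moves the two
  -- words differ by the letters ī i in front of r″. A comparison by columns has to wait until ρ
  -- contains all the rows above.
  data Effect (n : ℕ) (x : Letter k) (r : Row k) (t t′ : Tableau k) : Set where
    plainly    : (∀ v → reading t (x ∷ v) ≡A reading t′ v) → Effect n x r t t′
    cancelling : ∀ ρ i r″ t₀ → King n (ρ ++ (plain i ∷ r″) ∷ t₀) → top (ρ ++ (plain i ∷ r″) ∷ t₀) ≡ r →
      toℕ i ≡ n + length ρ →
      (∀ v → reading t (x ∷ v) ≡A reading t₀ (bar i ∷ plain i ∷ r″ ++ reading ρ v)) →
      (∀ v → reading t′ v ≡A reading t₀ (r″ ++ reading ρ v)) → Effect n x r t t′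

  record Outcome (n : ℕ) (x : Letter k) (t t′ : Tableau k) : Set where
    field
      {inserted} : Row k
      inserts    : RowInsert x (top t) inserted
      king       : King n t′
      tops       : ∀ {u} → Above u inserted → Above u (top t′)
      effect     : Effect n x inserted t t′

  -- A letter greater than x ≥ `plain n` violates the bound of the next row only if it is ī with
  -- index n. Then x is the unbarred letter of that index, and the insertion would have cancelled.
  next-row : ∀ {n} {x y : Letter k} {r} → (∀ i → x ≡ plain i → toℕ i ≡ n → All (_≢ bar i) r) → y ∈ r →
    2 * n ℕ.≤ rank x → x < y → 2 * suc n ℕ.≤ rank y
  next-row {n} {y = plain j} _ _ n≤x x<y = ℕ.*-monoʳ-≤ 2 (ℕ.*-cancelˡ-< 2 n (toℕ j) (ℕ.≤-<-trans n≤x x<y))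
  next-row {n} {x} {bar j} {r} unbarred y∈r n≤x x<y with toℕ j ℕ.≤? n
  ... | no  j≰n = ℕ.≤-trans (ℕ.*-monoʳ-≤ 2 (ℕ.≰⇒> j≰n)) (ℕ.m≤m+n _ 1)
  ... | yes j≤n = contradiction refl (All.lookup (forbidden x x≤plain n≤x unbarred) y∈r)
    where
    x≤plain : rank x ℕ.≤ 2 * toℕ j
    x≤plain = ℕ.s≤s⁻¹ (ℕ.≤-trans x<y (ℕ.≤-reflexive (ℕ.+-comm (2 * toℕ j) 1)))
    j≡n : toℕ j ≡ n
    j≡n = ℕ.≤-antisym j≤n (ℕ.*-cancelˡ-≤ 2 (ℕ.≤-trans n≤x x≤plain))
    forbidden : ∀ x → rank x ℕ.≤ 2 * toℕ j → 2 * n ℕ.≤ rank x →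
      (∀ i → x ≡ plain i → toℕ i ≡ n → All (_≢ bar i) r) → All (_≢ bar j) r
    forbidden (plain i) i≤j n≤i unbarred
      with refl ← Fin.toℕ-injective {i = i} {j} (ℕ.≤-antisym (ℕ.*-cancelˡ-≤ 2 i≤j) (ℕ.≤-trans j≤n (ℕ.*-cancelˡ-≤ 2 n≤i))) = unbarred j refl j≡n
    forbidden (bar i) i≤j n≤i _ = contradiction
      (ℕ.*-cancelˡ-< 2 (toℕ i) (toℕ j) (ℕ.≤-trans (plain<bar i) i≤j))
      (ℕ.≤⇒≯ (ℕ.≤-trans j≤n (ℕ.s≤s⁻¹ (ℕ.*-cancelˡ-< 2 n (suc (toℕ i))
        (ℕ.≤-trans (s≤s n≤i) (ℕ.≤-reflexive (trans (cong suc (ℕ.+-comm (2 * toℕ i) 1)) (sym (ℕ.*-suc 2 (toℕ i))))))))))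

  outcome : ∀ n x t → King n t → 2 * n ℕ.≤ rank x → Outcome n x t (insertFrom n x t)
  outcome n x [] _ n≤x = record
    { inserts = end
    ; king    = row (λ ()) [-] (n≤x ∷ []) [] []
    ; tops    = λ ab → ab
    ; effect  = plainly λ v → ε
    }
  outcome n x (r ∷ t) (row _ sorted bound ab king) n≤x with cancel n x r | cancel-view n x r sorted bound
  ... | _ | cancels {i} {l} {s} {r″} refl refl refl l≤i eq = record
    { inserts = inserts
    ; king    = Slid.king slid′
    ; tops    = λ { (u<i ∷ ab′) → Slid.tops slid′ (hole (ℕ.<⇒≤ u<i) ab′ (above-shift u<i ab′ (insert-sorted inserts sorted))) }
    ; effect  = cancelling [] i r″ t king′ refl (sym (ℕ.+-identityʳ _))
        (λ v → ≡A-reading t (≡A-reflexive (++-assoc l (bar i ∷ s) (plain i ∷ v))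
          ◅◅ row-bump l s v sorted l≤i (plain<bar i)
          ◅◅ ≡A-reflexive (cong (bar i ∷_) (trans (sym (++-assoc l (plain i ∷ s) v)) (cong (_++ v) eq)))))
        (λ v → ≡A-sym (Slid.words slid′ v))
    }
    where
    inserts : RowInsert (plain i) (l ++ bar i ∷ s) (plain i ∷ r″)
    inserts = subst (RowInsert (plain i) _) eq (insert-bump l≤i (plain<bar i))
    king′ : King n ((plain i ∷ r″) ∷ t)
    king′ = row (λ ()) (insert-sorted inserts sorted) (insert-all inserts n≤x bound) (insert-above inserts ab) king
    slid′ = slid [] (plain i) r″ t king′
  ... | _ | kept unbarred with break (x <?_) r | break-broken (x <?_) r
  ...   | _ | nowhere x≮r = record
    { inserts = inserts
    ; king    = row (insert-≢[] inserts) (insert-sorted inserts sorted) (insert-all inserts n≤x bound) (insert-above inserts ab) king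
    ; tops    = λ ab′ → ab′
    ; effect  = plainly λ v → ≡A-reflexive (cong (reading t) (sym (++-assoc r (x ∷ []) v)))
    }
    where
    inserts = insert-end (All.map ℕ.≮⇒≥ x≮r)
  ...   | l , _ | at {y = y} {s} refl x≮l x<y = record
    { inserts = inserts
    ; king    = king′ (Outcome.king ih) (Outcome.tops ih ab′)
    ; tops    = λ ab″ → ab″
    ; effect  = lift (Outcome.effect ih)
    }
    where
    l≤x : All (_≤ x) l
    l≤x = All.map ℕ.≮⇒≥ x≮l
    ih = outcome (suc n) y t king (next-row unbarred (∈-++⁺ʳ l (here refl)) n≤x x<y)
    inserts = insert-bump l≤x x<y
    ab′ : Above (l ++ x ∷ s) (Outcome.inserted ih)
    ab′ = bump-above l≤x x<y (Outcome.inserts ih) ab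
    king′ : ∀ {t′} → King (suc n) t′ → Above (l ++ x ∷ s) (top t′) → King n ((l ++ x ∷ s) ∷ t′)
    king′ kt above = row (++≢[] l) (insert-sorted inserts sorted) (insert-all inserts n≤x bound) above kt
    bumped : ∀ v → reading t ((l ++ y ∷ s) ++ x ∷ v) ≡A reading t (y ∷ (l ++ x ∷ s) ++ v)
    bumped v = ≡A-reading t (≡A-reflexive (++-assoc l (y ∷ s) (x ∷ v))
      ◅◅ row-bump l s v sorted l≤x x<y
      ◅◅ ≡A-reflexive (cong (y ∷_) (sym (++-assoc l (x ∷ s) v))))
    lift : ∀ {t′} → Effect (suc n) y (Outcome.inserted ih) t t′ →
      Effect n x (l ++ x ∷ s) ((l ++ y ∷ s) ∷ t) ((l ++ x ∷ s) ∷ t′)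
    lift (plainly words) = plainly λ v → bumped v ◅◅ words ((l ++ x ∷ s) ++ v)
    lift (cancelling ρ i r″ t₀ kt top≡ i≡ words words′) =
      cancelling ((l ++ x ∷ s) ∷ ρ) i r″ t₀ (king′ kt (subst (Above _) (sym top≡) ab′)) refl
        (trans i≡ (sym (ℕ.+-suc n (length ρ))))
        (λ v → bumped v ◅◅ words ((l ++ x ∷ s) ++ v))
        (λ v → words′ ((l ++ x ∷ s) ++ v))

-- Splitting off the first column

module _ {k : ℕ} where

  -- What remains of `King` when first columns are removed: the row bounds fail, and rows of length
  -- one become empty rows, which `tails` keeps.
  data Shape : Tableau k → Set where
    []  : Shape []
    row : ∀ {r t} → Sorted r → Above r (top t) → Shape t → Shape (r ∷ t)

  king-shape : ∀ {n t} → King n t → Shape t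
  king-shape []                       = []
  king-shape (row _ sorted _ ab king) = row sorted ab (king-shape king)

  heads : Tableau k → Word k
  heads []            = []
  heads ([] ∷ t)      = heads t
  heads ((a ∷ _) ∷ t) = a ∷ heads t

  tails : Tableau k → Tableau k
  tails []            = []
  tails ([] ∷ t)      = tails t
  tails ((_ ∷ y) ∷ t) = y ∷ tails t

  heads-++ : ∀ s t → heads (s ++ t) ≡ heads s ++ heads t
  heads-++ []            t = refl
  heads-++ ([] ∷ s)      t = heads-++ s t
  heads-++ ((a ∷ _) ∷ s) t = cong (a ∷_) (heads-++ s t)

  tails-++ : ∀ s t → tails (s ++ t) ≡ tails s ++ tails t
  tails-++ []            t = refl
  tails-++ ([] ∷ s)      t = tails-++ s t
  tails-++ ((_ ∷ y) ∷ s) t = cong (y ∷_) (tails-++ s t)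

  above-[] : ∀ {r} → Above {k} [] r → r ≡ []
  above-[] [] = refl

  heads-empty : ∀ {t} → Shape t → top t ≡ [] → heads t ≡ []
  heads-empty []                refl = refl
  heads-empty (row _ ab shape) refl = heads-empty shape (above-[] ab)

  tails-empty : ∀ {t} → Shape t → top t ≡ [] → tails t ≡ []
  tails-empty []                refl = refl
  tails-empty (row _ ab shape) refl = tails-empty shape (above-[] ab)

  heads-linked : ∀ {t} → Shape t → Linked _<_ (heads t)
  heads-linked []                             = []
  heads-linked {[] ∷ t}      (row _ _ shape)  = heads-linked shape
  heads-linked {(a ∷ _) ∷ t} (row _ ab shape) = cons t ab shape
    where
    cons : ∀ {y} t → Above (a ∷ y) (top t) → Shape t → Linked _<_ (a ∷ heads t)
    cons []            _         _     = [-]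
    cons ([] ∷ t)      _         shape rewrite heads-empty shape refl = [-]
    cons ((b ∷ _) ∷ t) (a<b ∷ _) shape = a<b ∷ heads-linked shape

  heads-tails : ∀ {t} → Shape t → Pairs (heads t) (tails t)
  heads-tails []                                = []
  heads-tails {[] ∷ t}      (row _ _ shape)      = heads-tails shape
  heads-tails {(_ ∷ _) ∷ t} (row sorted _ shape) = sorted ∷ heads-tails shape

  -- D and Z are the column and the tails of the rows below ρ. Heads are pulled from the lowest row
  -- of ρ upwards, so each is smaller than the column it joins.
  pull : ∀ ρ D Z v → Linked _<_ (heads ρ ++ D) → Pairs (heads ρ ++ D) (tails ρ ++ Z) →
    D ʳ++ reading Z (reading ρ v) ≡A (heads ρ ++ D) ʳ++ reading (tails ρ ++ Z) v
  pull []            D Z v _      _           = ε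
  pull ([] ∷ ρ)      D Z v linked ps          = pull ρ D Z v linked ps
  pull ((a ∷ y) ∷ ρ) D Z v linked (ay ∷ ps) =
    pull ρ D Z (a ∷ y ++ v) (Linked.tail linked) ps ◅◅ column-through _ _ (y ++ v) linked ps

  pull-shape : ∀ {t} v → Shape t → reading t v ≡A heads t ʳ++ reading (tails t) v
  pull-shape {t} v shape = subst₂ (λ c t′ → reading t v ≡A c ʳ++ reading t′ v) (++-identityʳ (heads t)) (++-identityʳ (tails t))
    (pull t [] [] v (subst (Linked _<_) (sym (++-identityʳ (heads t))) (heads-linked shape))
                    (subst₂ Pairs (sym (++-identityʳ (heads t))) (sym (++-identityʳ (tails t))) (heads-tails shape)))

  hole-pairs : ∀ {a p r″ t} ρ → All (_≢ []) ρ → Linked _<_ (a ∷ heads (ρ ++ (p ∷ r″) ∷ t)) →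
    Shape (ρ ++ (p ∷ r″) ∷ t) → Pairs (a ∷ heads ρ ++ heads t) (tails ρ ++ r″ ∷ tails t)
  hole-pairs []              _        (a<p ∷ _)      (row sorted _ shape) = sorted-lower a<p sorted ∷ heads-tails shape
  hole-pairs ([] ∷ ρ)        (ne ∷ _) _              _                    = contradiction refl ne
  hole-pairs ((b ∷ _) ∷ ρ) (_ ∷ ne) (a<b ∷ linked) (row sorted _ shape) =
    sorted-lower a<b sorted ∷ hole-pairs ρ ne linked shape

  linked-delete : ∀ A {p : Letter k} {C} → Linked _<_ (A ++ p ∷ C) → Linked _<_ (A ++ C)
  linked-delete []           linked             = Linked.tail linked
  linked-delete (a ∷ [])     {C = []}    _      = [-]
  linked-delete (a ∷ [])     {C = _ ∷ _} (p ∷ q ∷ linked) = ℕ.<-trans p q ∷ linked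
  linked-delete (a ∷ b ∷ A) (p ∷ linked)        = p ∷ linked-delete (b ∷ A) linked

  -- The hole left by p moves up the first column, so every tail is paired with the head of the row above it.
  pull-hole : ∀ ρ {p r″ t} v → All (_≢ []) ρ → Shape (ρ ++ (p ∷ r″) ∷ t) →
    heads t ʳ++ reading (tails t) (r″ ++ reading ρ v) ≡A (heads ρ ++ heads t) ʳ++ reading (tails ρ ++ r″ ∷ tails t) v
  pull-hole []            v _        _ = ε
  pull-hole ([] ∷ ρ)      v (ne ∷ _) _ = contradiction refl ne
  pull-hole ((a ∷ y) ∷ ρ) {p} {r″} {t} v (_ ∷ ne) (row sorted ab shape) =
    pull-hole ρ (a ∷ y ++ v) ne shape ◅◅ step ρ ne ab shape
    where
    move : ∀ {E z Z} → Sorted z → Above y z → Linked _<_ (a ∷ E) → Pairs E Z →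
      E ʳ++ reading (z ∷ Z) (a ∷ y ++ v) ≡A (a ∷ E) ʳ++ reading (y ∷ z ∷ Z) v
    move {E} {z} {Z} zs ab linked ps =
      -- The row z has lost its head and y lies above z, so `slide-right` read backwards takes a
      -- across z.
      ≡A-ʳ++ E (≡A-reading Z (≡A-sym (slide-right z y v sorted zs ab))) ◅◅ column-through E Z (z ++ y ++ v) linked ps
    linked : ∀ ρ → Above (a ∷ y) (top (ρ ++ (p ∷ r″) ∷ t)) → Shape (ρ ++ (p ∷ r″) ∷ t) → Linked _<_ (a ∷ heads ρ ++ heads t)
    linked ρ ab shape = linked-delete (a ∷ heads ρ)
      (subst (λ c → Linked _<_ (a ∷ c)) (heads-++ ρ _) (heads-linked (row sorted ab shape)))
    step : ∀ ρ → All (_≢ []) ρ → Above (a ∷ y) (top (ρ ++ (p ∷ r″) ∷ t)) → Shape (ρ ++ (p ∷ r″) ∷ t) →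
      (heads ρ ++ heads t) ʳ++ reading (tails ρ ++ r″ ∷ tails t) (a ∷ y ++ v) ≡A
      (a ∷ heads ρ ++ heads t) ʳ++ reading (y ∷ tails ρ ++ r″ ∷ tails t) v
    step [] _ ab@(_ ∷ ab′) shape@(row sorted′ _ shape′) =
      move (Linked.tail sorted′) ab′ (linked [] ab shape) (heads-tails shape′)
    step ([] ∷ ρ) (ne ∷ _) _ _ = contradiction refl ne
    step ((b ∷ z) ∷ ρ) (_ ∷ ne) ab@(_ ∷ ab′) shape@(row sorted′ _ shape′) =
      move (Linked.tail sorted′) ab′ (linked ((b ∷ z) ∷ ρ) ab shape) (hole-pairs ρ ne (heads-linked shape) shape′)

  king-rows : ∀ {n} (ρ : Tableau k) {t} → King n (ρ ++ t) → All (_≢ []) ρ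
  king-rows []      _                   = []
  king-rows (_ ∷ ρ) (row ne _ _ _ king) = ne ∷ king-rows ρ king

  length-heads : ∀ {ρ : Tableau k} → All (_≢ []) ρ → length (heads ρ) ≡ length ρ
  length-heads                []        = refl
  length-heads {[] ∷ _}       (ne ∷ _)  = contradiction refl ne
  length-heads {(_ ∷ _) ∷ _} (_ ∷ nes) = cong suc (length-heads nes)

  king-drop : ∀ {n} (ρ : Tableau k) {t} → King n (ρ ++ t) → King (n + length ρ) t
  king-drop {n} []      {t} king           = subst (λ n → King n t) (sym (ℕ.+-identityʳ n)) king
  king-drop {n} (_ ∷ ρ) {t} (row _ _ _ _ king) =
    subst (λ n → King n t) (sym (ℕ.+-suc n (length ρ))) (king-drop ρ king)

  heads-bound : ∀ {n t} → King n t → All (λ x → 2 * n ℕ.≤ rank x) (heads t)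
  heads-bound {n} []                                              = []
  heads-bound {n} {[] ∷ _}      (row ne _ _ _ _)                  = contradiction refl ne
  heads-bound {n} {(_ ∷ _) ∷ _} (row _ _ (n≤a ∷ _) _ king) =
    n≤a ∷ All.map (ℕ.≤-trans (ℕ.*-monoʳ-≤ 2 (ℕ.n≤1+n n))) (heads-bound king)

  heads-king : ∀ {n t} → King n t → KingFrom n (heads t)
  heads-king []                                      = []
  heads-king {t = [] ∷ _}      (row ne _ _ _ _)      = contradiction refl ne
  heads-king {t = (_ ∷ _) ∷ _} (row _ _ (n≤a ∷ _) _ king) = n≤a ∷ heads-king king

  linked-replace : ∀ A {x : Letter k} {C D} → Linked _<_ (A ++ x ∷ C) → Linked _<_ (x ∷ D) → Linked _<_ (A ++ x ∷ D)
  linked-replace []           _             linked = linked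
  linked-replace (a ∷ [])     (p ∷ _)       linked = p ∷ linked
  linked-replace (a ∷ b ∷ A) (p ∷ linked′) linked = p ∷ linked-replace (b ∷ A) linked′ linked

  pairs-replace : ∀ ρ {C Z : Word k} {D Y} → Pairs (heads ρ ++ C) (tails ρ ++ D) → Pairs Z Y → Pairs (heads ρ ++ Z) (tails ρ ++ Y)
  pairs-replace []            _         ps′ = ps′
  pairs-replace ([] ∷ ρ)      ps        ps′ = pairs-replace ρ ps ps′
  pairs-replace ((_ ∷ _) ∷ ρ) (ay ∷ ps) ps′ = ay ∷ pairs-replace ρ ps ps′

  linked-ascending : ∀ {c : Word k} → Linked _<_ c → Ascending c
  linked-ascending = Linked⇒AllPairs ℕ.<-trans

  reverse-column : ∀ {c : Word k} → Linked _<_ c → ColumnWord (reverse c)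
  reverse-column []                  = []
  reverse-column {x ∷ c} linked = onto c [] linked [-]
    where
    onto : ∀ {x} c v → Linked _<_ (x ∷ c) → ColumnWord (x ∷ v) → ColumnWord (c ʳ++ x ∷ v)
    onto []      v _              column = column
    onto (y ∷ c) v (x<y ∷ linked) column = onto c (_ ∷ v) linked (x<y ∷ column)

  -- Berele insertion as Knuth moves and column replacements

  infix 4 _⇝_

  -- Unlike in ≡5, the column words have ≈-equal codes instead of equal images under P-C: that the latter
  -- implies the former is only known at the end.
  data _⇝_ (w w′ : Word k) : Set where
    plactic : w ≡A w′ → w ⇝ w′
    column  : ∀ c c′ v → ColumnWord c → ColumnWord c′ → code c ≈ code c′ → w ≡A c ++ v → w′ ≡A c′ ++ v → w ⇝ w′

  ⇝-++ʳ : ∀ {w w′} v → w ⇝ w′ → w ++ v ⇝ w′ ++ v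
  ⇝-++ʳ v (plactic eq) = plactic (≡A-++ʳ v eq)
  ⇝-++ʳ v (column c c′ u col col′ c≈c′ eq eq′) = column c c′ (u ++ v) col col′ c≈c′
    (≡A-++ʳ v eq ◅◅ ≡A-reflexive (++-assoc c u v)) (≡A-++ʳ v eq′ ◅◅ ≡A-reflexive (++-assoc c′ u v))

  ≈-⇝ : ∀ {w w′} → w ⇝ w′ → code w ≈ code w′
  ≈-⇝ (plactic eq) = ≈-≡A eq
  ≈-⇝ (column c c′ v _ _ c≈c′ eq eq′) = ≈-trans (≈-≡A eq) (≈-trans (≈-++ʷ {u = c} {c′} v c≈c′) (≈-sym (≈-≡A eq′)))

  ≈-⇝* : ∀ {w w′} → Star _⇝_ w w′ → code w ≈ code w′
  ≈-⇝* ε        = ≈-refl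
  ≈-⇝* (s ◅ ss) = ≈-trans (≈-⇝ s) (≈-⇝* ss)

  -- Both words split into a column word and the same V, the row word of everything right of the
  -- first column. The columns are A , i , ī , C and A , C, so they differ by a pair that
  -- `cancelCol` deletes.
  cancel-step : ∀ ρ i r″ {t w w′} → King 0 (ρ ++ (plain i ∷ r″) ∷ t) → toℕ i ≡ length ρ →
    w ≡A reading t (bar i ∷ plain i ∷ r″ ++ reading ρ []) → w′ ≡A reading t (r″ ++ reading ρ []) → w ⇝ w′
  cancel-step ρ i r″ {t} {w} {w′} king i≡ eq eq′ =
    column (reverse c) (reverse c′) V (reverse-column linked) (reverse-column linked′) agree
      (subst (w ≡A_) (ʳ++-defn c {V}) (eq ◅◅ paired)) (subst (w′ ≡A_) (ʳ++-defn c′ {V}) (eq′ ◅◅ pull-shape _ (king-shape kingₜ) ◅◅ pull-hole ρ [] rows shape))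
    where
    A = heads ρ
    C = heads t
    c = A ++ plain i ∷ bar i ∷ C
    c′ = A ++ C
    V = reading (tails ρ ++ r″ ∷ tails t) []
    rows = king-rows ρ king
    shape = king-shape king
    heads≡ : heads (ρ ++ (plain i ∷ r″) ∷ t) ≡ A ++ plain i ∷ C
    heads≡ = heads-++ ρ _
    linked₀ : Linked _<_ (A ++ plain i ∷ C)
    linked₀ = subst (Linked _<_) heads≡ (heads-linked shape)
    kingᵢ : King (toℕ i) ((plain i ∷ r″) ∷ t)
    kingᵢ = subst (λ n → King n ((plain i ∷ r″) ∷ t)) (sym i≡) (king-drop ρ king)
    kingₜ : King (suc (toℕ i)) t
    kingₜ with row _ _ _ _ kt ← kingᵢ = kt
    sorted : Sorted (plain i ∷ r″)
    sorted with row s _ _ ← king-shape kingᵢ = s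
    i<C : All (bar i <_) C
    i<C = All.map (ℕ.<-≤-trans (ℕ.≤-reflexive
      (trans (cong suc (ℕ.+-comm (2 * toℕ i) 1)) (sym (ℕ.*-suc 2 (toℕ i)))))) (heads-bound kingₜ)
    linkedᵦ : Linked _<_ (bar i ∷ C)
    linkedᵦ = cons C i<C (heads-linked (king-shape kingₜ))
      where
      cons : ∀ C → All (bar i <_) C → Linked _<_ C → Linked _<_ (bar i ∷ C)
      cons []      _         _      = [-]
      cons (_ ∷ _) (i<x ∷ _) linked = i<x ∷ linked
    linked : Linked _<_ c
    linked = linked-replace A linked₀ (plain<bar i ∷ linkedᵦ)
    linked′ : Linked _<_ c′
    linked′ = linked-delete A linked₀
    pairsₜ : Pairs C (tails t)
    pairsₜ = heads-tails (king-shape kingₜ)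
    paired : reading t (bar i ∷ plain i ∷ r″ ++ reading ρ []) ≡A c ʳ++ V
    paired =
      pull-shape _ (king-shape kingₜ)
      -- ī and then i are smaller than the column gathered so far, so each crosses the tails and
      -- joins it.
      ◅◅ column-through C (tails t) _ linkedᵦ pairsₜ
      ◅◅ column-through (bar i ∷ C) (tails t) _ (plain<bar i ∷ linkedᵦ) (pairs-shift linkedᵦ pairsₜ)
      ◅◅ pull ρ (plain i ∷ bar i ∷ C) (r″ ∷ tails t) [] linked
           (pairs-replace ρ (subst₂ Pairs heads≡ (tails-++ ρ _) (heads-tails shape)) (sorted ∷ pairs-shift linkedᵦ pairsₜ))
    agree : code (reverse c) ≈ code (reverse c′)
    agree = ≈-trans (code-column [] (linked-ascending linked))
      (≈-trans (≈-cancel (indicator c) (cancel-indicator A C i (trans (length-heads rows) (sym i≡))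
                  (linked-ascending linked₀) i<C (subst (KingFrom 0) heads≡ (heads-king king))))
               (≈-sym (code-column [] (linked-ascending linked′))))

  reading-++ : ∀ t (u v : Word k) → reading t u ++ v ≡ reading t (u ++ v)
  reading-++ []      u v = refl
  reading-++ (r ∷ t) u v = trans (reading-++ t (r ++ u) v) (cong (reading t) (++-assoc r u v))

  berele-step : ∀ t x → King 0 t → reading t (x ∷ []) ⇝ reading (t ←C x) []
  berele-step t x king with Outcome.effect (outcome 0 x t king ℕ.z≤n)
  ... | plainly words = plactic (words [])
  ... | cancelling ρ i r″ t₀ king′ _ i≡ words words′ = cancel-step ρ i r″ king′ i≡ (words []) (words′ [])

  berele : ∀ {t u} w → King 0 t → Star _⇝_ u (reading t []) →
    King 0 (foldl _←C_ t w) × Star _⇝_ (u ++ w) (reading (foldl _←C_ t w) [])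
  berele {t} {u} []      king steps = king , subst (λ u → Star _⇝_ u (reading t [])) (sym (++-identityʳ u)) steps
  berele {t} {u} (x ∷ w) king steps =
    let (king′ , steps′) = berele {u = u ++ x ∷ []} w (Outcome.king (outcome 0 x t king ℕ.z≤n))
          (gmap (_++ x ∷ []) (⇝-++ʳ (x ∷ [])) steps
           ◅◅ subst (λ w → Star _⇝_ (reading t [] ++ x ∷ []) w) (reading-++ t [] (x ∷ [])) ε
           ◅◅ berele-step t x king ◅ ε)
    in king′ , subst (λ w → Star _⇝_ w _) (++-assoc u (x ∷ []) w) steps′

  P-C-king : ∀ w → King 0 (P-C w)
  P-C-king w = proj₁ (berele w [] ε)

  P-C-word : ∀ w → Star _⇝_ w (reading (P-C w) [])
  P-C-word w = proj₂ (berele w [] ε)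

-- The columns of a King tableau and the equivalence

module _ {k : ℕ} where

  tails-shape : ∀ {t} → Shape {k} t → Shape (tails t)
  tails-shape []                                 = []
  tails-shape {[] ∷ t}      (row _ _ shape)      = tails-shape shape
  tails-shape {(a ∷ y) ∷ t} (row sorted ab shape) = row (Linked.tail sorted) (cons t ab shape) (tails-shape shape)
    where
    cons : ∀ t → Above (a ∷ y) (top t) → Shape t → Above y (top (tails t))
    cons []            _        _     = []
    cons ([] ∷ t)      _        shape rewrite tails-empty shape refl = []
    cons ((_ ∷ _) ∷ t) (_ ∷ ab) _     = ab

  heads-dominate : ∀ {t} → Shape {k} t → Dominates (heads t) (heads (tails t))
  heads-dominate []                                       = []
  heads-dominate {[] ∷ t}          (row _ _ shape)        = heads-dominate shape
  heads-dominate {(_ ∷ _ ∷ _) ∷ t} (row (p ∷ _) _ shape)  = p ∷ heads-dominate shape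
  heads-dominate {(a ∷ []) ∷ t}    shape rewrite heads-empty (tails-shape shape) refl = []

  columns : ℕ → Tableau k → List (Word k)
  columns zero    t = []
  columns (suc m) t = heads t ∷ columns m (tails t)

  columns-king : ∀ m {t c cs} → Shape t → length (top t) ≡ m → Dominates c (heads t) → KingColumns (c ∷ cs) →
    KingColumns (columns m t ʳ++ (c ∷ cs))
  columns-king zero                    _     _   _   cols = cols
  columns-king (suc m) {[] ∷ _}        _     ()
  columns-king (suc m) {(_ ∷ _) ∷ _}  shape len dom cols =
    columns-king m (tails-shape shape) (ℕ.suc-injective len) (heads-dominate shape)
      (next (λ ()) (linked-ascending (heads-linked shape)) dom cols)

  kingColumns : Tableau k → List (Word k)
  kingColumns t = reverse (columns (length (top t)) t)

  kingColumns-king : ∀ {t} → King 0 t → KingColumns (kingColumns t)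
  kingColumns-king {[]}          _    = []
  kingColumns-king {[] ∷ _}      (row ne _ _ _ _) = contradiction refl ne
  kingColumns-king {(_ ∷ _) ∷ _} king =
    columns-king _ (tails-shape shape) refl (heads-dominate shape)
      (first (λ ()) (linked-ascending (heads-linked shape)) (heads-king king))
    where shape = king-shape king

  length-0 : ∀ (r : Row k) → length r ≡ 0 → r ≡ []
  length-0 [] _ = refl

  reading-empty : ∀ {t} v → Shape {k} t → top t ≡ [] → reading t v ≡ v
  reading-empty v []              refl = refl
  reading-empty v (row _ ab shape) refl = reading-empty v shape (above-[] ab)

  columns-word : ∀ m {t} cs → Shape t → length (top t) ≡ m →
    columnsWord cs ++ reading t [] ≡A columnsWord (columns m t ʳ++ cs)
  columns-word zero {t} cs shape len =
    ≡A-reflexive (trans (cong (columnsWord cs ++_) (reading-empty [] shape (length-0 (top t) len))) (++-identityʳ _))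
  columns-word (suc m) {[] ∷ _} cs _ ()
  columns-word (suc m) {t@((_ ∷ _) ∷ _)} cs shape len =
    ≡A-++ˡ (columnsWord cs) (pull-shape [] shape)
    ◅◅ ≡A-reflexive (trans (cong (columnsWord cs ++_) (ʳ++-defn (heads t))) (sym (++-assoc (columnsWord cs) (reverse (heads t)) _)))
    ◅◅ columns-word m (heads t ∷ cs) (tails-shape shape) (ℕ.suc-injective len)

  code-king : ∀ {t} → King 0 t → code (reading t []) ≈ map indicator (kingColumns t)
  code-king king = ≈-trans (≈-≡A (columns-word _ [] (king-shape king) refl)) (code-columns (kingColumns-king king))

  length-tails : ∀ (t : Tableau k) → length (tails t) ≡ length (heads t)
  length-tails []            = refl
  length-tails ([] ∷ t)      = length-tails t
  length-tails ((_ ∷ _) ∷ t) = cong suc (length-tails t)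

  rebuild : ∀ {t t′} → Shape {k} t → Shape t′ → length t ≡ length t′ → heads t ≡ heads t′ → tails t ≡ tails t′ → t ≡ t′
  rebuild [] [] _ _ _ = refl
  rebuild {[] ∷ t} {[] ∷ t′} (row _ _ s) (row _ _ s′) len hs ts = cong ([] ∷_) (rebuild s s′ (ℕ.suc-injective len) hs ts)
  rebuild {[] ∷ t} {(_ ∷ _) ∷ t′} s _ _ hs _ with () ← trans (sym (heads-empty s refl)) hs
  rebuild {(_ ∷ _) ∷ t} {[] ∷ t′} _ s′ _ hs _ with () ← trans hs (heads-empty s′ refl)
  rebuild {(_ ∷ _) ∷ t} {(_ ∷ _) ∷ t′} (row _ _ s) (row _ _ s′) len hs ts = cong₂ _∷_
    (cong₂ _∷_ (∷-injectiveˡ hs) (∷-injectiveˡ ts)) (rebuild s s′ (ℕ.suc-injective len) (∷-injectiveʳ hs) (∷-injectiveʳ ts))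

  -- Columns do not show trailing empty rows, so the number of rows is a separate hypothesis; for
  -- the tails it is the length of the first column.
  columns-injective : ∀ m m′ {t t′} → Shape t → Shape t′ → length (top t) ≡ m → length (top t′) ≡ m′ →
    length t ≡ length t′ → columns m t ≡ columns m′ t′ → t ≡ t′
  columns-injective zero zero {t} {t′} s s′ len len′ rows _ = rebuild s s′ rows
    (trans (heads-empty s (length-0 (top t) len)) (sym (heads-empty s′ (length-0 (top t′) len′))))
    (trans (tails-empty s (length-0 (top t) len)) (sym (tails-empty s′ (length-0 (top t′) len′))))
  columns-injective (suc m) (suc m′) {t} {t′} s s′ len len′ rows eq = rebuild s s′ rows (∷-injectiveˡ eq)
    (columns-injective m m′ (tails-shape s) (tails-shape s′) (top-tails t len) (top-tails t′ len′)
      (trans (length-tails t) (trans (cong length (∷-injectiveˡ eq)) (sym (length-tails t′)))) (∷-injectiveʳ eq))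
    where
    top-tails : ∀ (t : Tableau k) {m} → length (top t) ≡ suc m → length (top (tails t)) ≡ m
    top-tails ((_ ∷ _) ∷ _) len = ℕ.suc-injective len

  kingColumns-injective : ∀ {t t′} → King 0 t → King 0 t′ → kingColumns t ≡ kingColumns t′ → t ≡ t′
  kingColumns-injective {t} {t′} king king′ eq =
    columns-injective _ _ (king-shape king) (king-shape king′) refl refl (rows t t′ king king′ columns≡) columns≡
    where
    columns≡ : columns (length (top t)) t ≡ columns (length (top t′)) t′
    columns≡ = reverse-injective eq
    rows : ∀ t t′ → King 0 t → King 0 t′ → columns (length (top t)) t ≡ columns (length (top t′)) t′ → length t ≡ length t′
    rows [] [] _ _ _ = refl
    rows ([] ∷ _) _ (row ne _ _ _ _) _ _ = contradiction refl ne
    rows _ ([] ∷ _) _ (row ne _ _ _ _) _ = contradiction refl ne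
    rows t@((_ ∷ _) ∷ _) t′@((_ ∷ _) ∷ _) king king′ eq =
      trans (sym (length-heads (nonempty king))) (trans (cong length (∷-injectiveˡ eq)) (length-heads (nonempty king′)))
      where
      nonempty : ∀ {n} {t : Tableau k} → King n t → All (_≢ []) t
      nonempty []                  = []
      nonempty (row ne _ _ _ king) = ne ∷ nonempty king

  -- From here on, equality of insertion tableaux and `≈` of codes are interchangeable. This lets
  -- `≈-≡C` handle `≡5` steps and turns `⇝` into `≡C`.
  code-P-C : ∀ w → code w ≈ map indicator (kingColumns (P-C {k} w))
  code-P-C w = ≈-trans (≈-⇝* (P-C-word w)) (code-king (P-C-king w))

  ≈⇒P-C : ∀ {w w′ : Word k} → code w ≈ code w′ → P-C w ≡ P-C w′
  ≈⇒P-C {w} {w′} eq = kingColumns-injective (P-C-king w) (P-C-king w′)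
    (king-columns-unique (kingColumns-king (P-C-king w)) (kingColumns-king (P-C-king w′))
      (≈-trans (≈-sym (code-P-C w)) (≈-trans eq (code-P-C w′))))

  P-C⇒≈ : ∀ {w w′ : Word k} → P-C w ≡ P-C w′ → code w ≈ code w′
  P-C⇒≈ {w} {w′} eq =
    ≈-trans (code-P-C w) (subst (λ t → map indicator (kingColumns t) ≈ code w′) (sym eq) (≈-sym (code-P-C w′)))

  ≡5-sym : ∀ {w w′ : Word k} → w ≡5 w′ → w′ ≡5 w
  ≡5-sym (v , c , c′ , col , col′ , eq , eq′ , c∼c′) = v , c′ , c , col′ , col , eq′ , eq , sym c∼c′

  ≡C-sym : ∀ {w w′ : Word k} → w ≡C w′ → w′ ≡C w
  ≡C-sym = Star.reverse λ
    { (inj₁ (fwd m)) → inj₁ (bwd m)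
    ; (inj₁ (bwd m)) → inj₁ (fwd m)
    ; (inj₂ eq)      → inj₂ (≡5-sym eq)
    }

  ≈-≡C : ∀ {w w′ : Word k} → w ≡C w′ → code w ≈ code w′
  ≈-≡C ε                    = ≈-refl
  ≈-≡C (inj₁ (fwd m) ◅ eqs) = ≈-trans (≈-knuth m) (≈-≡C eqs)
  ≈-≡C (inj₁ (bwd m) ◅ eqs) = ≈-trans (≈-sym (≈-knuth m)) (≈-≡C eqs)
  ≈-≡C (inj₂ (v , c , c′ , _ , _ , eq , eq′ , c∼c′) ◅ eqs) =
    ≈-trans (≈-≡A eq) (≈-trans (≈-++ʷ {u = c} {c′} v (P-C⇒≈ {c} {c′} c∼c′)) (≈-trans (≈-sym (≈-≡A eq′)) (≈-≡C eqs)))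

  ⇝⇒≡C : ∀ {w w′ : Word k} → w ⇝ w′ → w ≡C w′
  ⇝⇒≡C (plactic eq) = Star.map inj₁ eq
  ⇝⇒≡C (column c c′ v col col′ c≈c′ eq eq′) =
    inj₂ (v , c , c′ , col , col′ , eq , eq′ , ≈⇒P-C {c} {c′} c≈c′) ◅ ε

  P-C-≡C : ∀ (w : Word k) → w ≡C reading (P-C w) []
  P-C-≡C w = Star.concat (Star.map ⇝⇒≡C (P-C-word w))

corollary3p18 : (k : ℕ) → .{{_ : NonZero k}} → (w w′ : Word k) → (w ≡C w′) ⇔ (P-C w ≡ P-C w′)
corollary3p18 k w w′ = mk⇔
  (λ eq → ≈⇒P-C {w = w} {w′} (≈-≡C eq))
  (λ eq → P-C-≡C w ◅◅ subst (λ t → reading t [] ≡C w′) (sym eq) (≡C-sym (P-C-≡C w′)))
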